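{- Let $s,t\ge 1$ be coprime integers. Then $$\frac{\sum_{\lambda\in \mathcal{D}_s\cap \mathcal{D}_t} |\lambda|}{\sum_{\lambda\in \mathcal{D}_s\cap \mathcal{D}_t} 1} = \frac{1}{24}(s-1)(t-1)(s+t+1),$$ where the (finite) sums run over all self-conjugate partitions that are simultaneously $s$-cores and $t$-cores.
   Context: A partition is an infinite weakly decreasing sequence $\lambda=(\lambda_1,\lambda_2,\ldots)$ of nonnegative integers with finite size $|\lambda|=\lambda_1+\lambda_2+\cdots$. Its Young diagram is $[\lambda]=\{(r,c)\in\mathbb{Z}_{>0}^2 : c\le\lambda_r\}$, and its conjugate $\overline{\lambda}$ is defined by $\overline{\lambda}_r=\#\{c\in\mathbb{Z}_{>0}: r\le\lambda_c\}$; $\lambda$ is self-conjugate if $\lambda=\overline{\lambda}$. The hook length at $(r,c)\in[\lambda]$ is $1+(\lambda_r-r)+(\overline{\lambda}_c-c)$. For $s\ge1$, a partition is an $s$-core if it has no hook of length $s$; $\mathcal{C}_s$ denotes the set of $s$-cores and $\mathcal{D}_s\subseteq\mathcal{C}_s$ the set of self-conjugate $s$-cores. For coprime $s,t\ge 1$ the set $\mathcal{C}_s\cap\mathcal{C}_t$ is finite. -}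

module Defs where

open import Data.Nat using (ℕ; suc; _≤_; _<_; _<?_)
open import Data.Integer as ℤ using (ℤ; +_; 1ℤ)
open import Data.List using (List; length; map; filter; upTo)
open import Data.List.Relation.Unary.All using (All)
open import Data.Nat.ListAction using (sum)
import Data.List.Membership.Setoid as Membership
import Data.List.Relation.Unary.Unique.Setoid as Uniqueness
open import Level using (0ℓ)
open import Relation.Binary.Bundles using (Setoid)
import Relation.Binary.Construct.On as On
open import Relation.Binary.PropositionalEquality using (_≡_; _≢_; _→-setoid_)
open import Relation.Unary using (Pred; _∩_)

-- Rows and columns are numbered from 0: part λ r is λ_{r+1}.  For a weakly
-- decreasing sequence of naturals, finite size means being eventually zero;
-- bound is any (not necessarily least) witness of this.
record Partition : Set where
  field
    part       : ℕ → ℕ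
    decreasing : ∀ r → part (suc r) ≤ part r
    bound      : ℕ
    vanishing  : ∀ r → bound ≤ r → part r ≡ 0

open Partition public

-- Two partitions are equal when they are equal as sequences; the choice of
-- bound is irrelevant.
partitionSetoid : Setoid 0ℓ 0ℓ
partitionSetoid = On.setoid (ℕ →-setoid ℕ) part

size : Partition → ℕ
size p = sum (map (part p) (upTo (bound p)))

-- conjugate p r = #{ c : r + 1 ≤ part p c }.  Only c < bound p can contribute,
-- since part p vanishes from bound p on.
conjugate : Partition → ℕ → ℕ
conjugate p r = length (filter (λ c → r <? part p c) (upTo (bound p)))

SelfConjugate : Pred Partition 0ℓ
SelfConjugate p = ∀ r → part p r ≡ conjugate p r

InDiagram : Partition → ℕ → ℕ → Set
InDiagram p r c = c < part p r

-- The cell (r , c) has 1-based coordinates (r + 1 , c + 1).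
hookLength : Partition → ℕ → ℕ → ℤ
hookLength p r c =
  1ℤ ℤ.+ (+ part p r ℤ.- + suc r) ℤ.+ (+ conjugate p c ℤ.- + suc c)

𝒞 : ℕ → Pred Partition 0ℓ
𝒞 s p = ∀ r c → InDiagram p r c → hookLength p r c ≢ + s

𝒟 : ℕ → Pred Partition 0ℓ
𝒟 s = SelfConjugate ∩ 𝒞 s

-- A proof that a set of partitions is finite: a list of all its elements
-- without repetition.
record Finite (P : Pred Partition 0ℓ) : Set where
  open Membership partitionSetoid using (_∈_)
  open Uniqueness partitionSetoid using (Unique)
  field
    elements : List Partition
    unique   : Unique elements
    sound    : All P elements
    complete : ∀ p → P p → p ∈ elements

-- The sum of f over a finite set.  It does not depend on the enumeration as
-- long as f respects equality of partitions, as size and constants do.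
∑ : ∀ {P} → Finite P → (Partition → ℕ) → ℕ
∑ F f = sum (map f (Finite.elements F))

-- Record a partition λ by its beads γ = λ_r − r − 1.  If λ is self-conjugate,
-- then exactly one of γ and −1 − γ is a bead for every integer γ, λ is an
-- s-core if and only if the beads are closed under γ ↦ γ − s, and |λ| is the
-- sum of 2γ + 1 over the nonnegative beads.  Put h = (s − 1)(t − 1)/2 and write
-- γ = t i + s j − h with 0 ≤ i < s.  For an (s,t)-core the beads with
-- coordinate i are those with j < G i, where G is weakly decreasing,
-- G (s − 1 − i) = − G i and 2 (G 0) ≤ t.  So the cores correspond to partitions
-- g in an ⌊s/2⌋ × ⌊t/2⌋ box, and |λ| is the sum of s g_i² + t (2i + 1 − s) g_i
-- up to a constant.  The constant is read off from the empty partition: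
-- completing the square in each term leaves, up to signs and order, the numbers
-- 2i + 1 − s.  What remains are the averages of Σ g_i² and Σ (2i + 1) g_i over
-- the box, which follow from the recursion that removes either a first row of
-- maximal length or the last column of the box.
module Submission where

open import Defs
open import Algebra.Properties.AbelianGroup using (∙-cancelʳ)
import Algebra.Properties.CommutativeSemigroup as CommutativeSemigroupₚ
open import Data.Bool as Bool using (true; false; if_then_else_)
open import Data.Empty using (⊥; ⊥-elim)
open import Data.Integer as ℤ
  using (ℤ; +_; -[1+_]; 0ℤ; 1ℤ; -1ℤ; _+_; _-_; _*_; -_; +<+; -<+; +≤+; _%ℕ_; _/ℕ_)
import Data.Integer.DivMod as ℤDivMod
import Data.Integer.Properties as ℤₚ
open import Data.Integer.Tactic.RingSolver using (solve-∀)
open import Data.List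
  using (List; []; _∷_; _++_; length; map; filter; upTo; downFrom; applyUpTo; cartesianProduct)
import Data.List.Properties as Listₚ
open import Data.List.Membership.Propositional using (_∈_)
open import Data.List.Membership.Propositional.Properties
open import Data.List.Membership.Propositional.Properties.WithK using (unique∧set⇒bag)
open import Data.List.Relation.Binary.BagAndSetEquality using (∼bag⇒↭)
import Data.List.Relation.Binary.Permutation.Propositional as Perm
open import Data.List.Relation.Binary.Permutation.Propositional using (_↭_)
import Data.List.Relation.Binary.Permutation.Propositional.Properties as Permₚ
open import Data.List.Relation.Unary.All as All using (All; []; _∷_)
import Data.List.Relation.Unary.All.Properties as Allₚ
open import Data.List.Relation.Unary.AllPairs using (AllPairs; []; _∷_)
import Data.List.Relation.Unary.AllPairs.Properties as AllPairsₚ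
open import Data.List.Relation.Unary.Any as Any using (here; there)
import Data.List.Relation.Unary.Any.Properties as Anyₚ
open import Data.List.Relation.Unary.Unique.Propositional using (Unique)
import Data.List.Relation.Unary.Unique.Propositional.Properties as Uniqueₚ
open import Data.Nat as ℕ using (ℕ; zero; suc; z≤n; s≤s; _≤_; _<_; _<?_; NonZero)
open import Data.Nat.Coprimality as Coprimality using (Coprime)
open import Data.Nat.Divisibility using (divides)
import Data.Nat.GCD as GCD
open import Data.Nat.Induction using (<-rec)
open import Data.Nat.ListAction using (sum)
import Data.Nat.Properties as ℕₚ
open import Data.Product using (Σ-syntax; ∃-syntax; ∃₂; _×_; _,_; proj₁; proj₂)
open import Data.Rational using (_/_)
import Data.Rational.Properties as ℚₚ
open import Data.Rational.Unnormalised using (mkℚᵘ; *≡*)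
open import Data.Sum using (_⊎_; inj₁; inj₂; swap; [_,_]′)
open import Function using (_∘_; id; case_of_)
open import Function.Bundles using (mk⇔)
open import Level using (0ℓ)
open import Relation.Binary using (tri<; tri≈; tri>)
open import Relation.Binary.PropositionalEquality hiding ([_])
open import Relation.Nullary using (¬_; Dec; yes; no; contradiction)
open import Relation.Unary using (Pred; Decidable; _∩_)

-- Beads of self-conjugate partitions

-- The constant h is the shift for which γ ↦ -1 - γ becomes the point reflection (i, j) ↦ (s - 1 -
-- i, -1 - j) of the lattice; this gives the antisymmetry of G. Subtracting t lowers i by 1, but
-- from row 0 it leads to row s - 1 and lowers j by t. Closure there reads G 0 ≤ G (s - 1) + t,
-- which is the bound 2 (G 0) ≤ t. The obstacle is that |λ| sums over the nonnegative beads, while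
-- the sign of a lattice point depends on the arithmetic of s and t. So the sum is indexed by the
-- box instead, which has one point for each antipodal pair that matters, and each pair contributes
-- the positive part of 2γ + 1 for whichever member is a bead. As 2γ + 1 changes sign under γ ↦ -1 -
-- γ, exchanging the members changes the contribution by exactly 2γ + 1, whatever the signs. Hence
-- the dependence on g is polynomial, and the sign-dependent rest is the same for all g. It is never
-- evaluated directly: the empty partition has size 0.

module _ {A : Set} {P : Pred A 0ℓ} (P? : Decidable P) where

  private
    downTo0 : ∀ (f : ℕ → A) → (∀ c → P (f (suc c)) → P (f c)) → ∀ c → P (f c) → P (f 0)
    downTo0 f down zero    p = p
    downTo0 f down (suc c) p = downTo0 f down c (down c p)

  -- Since `P ∘ f` is downward closed, the filter keeps an initial segment, so comparing with its
  -- length is testing `P`. A general `f` in place of `id` lets the induction shift the index.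
  <length-filter⁻ : ∀ (f : ℕ → A) n → (∀ c → P (f (suc c)) → P (f c)) →
                    ∀ {c} → c < length (filter P? (applyUpTo f n)) → c < n × P (f c)
  <length-filter⁻ f (suc n) down {c} lt with P? (f 0)
  ... | no ¬p = contradiction (downTo0 f down (suc c) (proj₂ (<length-filter⁻ (f ∘ suc) n (down ∘ suc) lt))) ¬p
  <length-filter⁻ f (suc n) down {zero}  lt       | yes p = s≤s z≤n , p
  <length-filter⁻ f (suc n) down {suc c} (s≤s lt) | yes p =
    let c<n , q = <length-filter⁻ (f ∘ suc) n (down ∘ suc) lt in s≤s c<n , q

  <length-filter⁺ : ∀ (f : ℕ → A) n → (∀ c → P (f (suc c)) → P (f c)) →
                    ∀ {c} → c < n → P (f c) → c < length (filter P? (applyUpTo f n))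
  <length-filter⁺ f (suc n) down {c} c<n p with P? (f 0)
  ... | no ¬p = contradiction (downTo0 f down c p) ¬p
  <length-filter⁺ f (suc n) down {zero}  _         p | yes _ = s≤s z≤n
  <length-filter⁺ f (suc n) down {suc c} (s≤s c<n) p | yes _ = s≤s (<length-filter⁺ (f ∘ suc) n (down ∘ suc) c<n p)

≡-by-< : ∀ {m n} → (∀ {k} → k < m → k < n) → (∀ {k} → k < n → k < m) → m ≡ n
≡-by-< {m} {n} f g with ℕₚ.<-cmp m n
... | tri< m<n _ _ = ⊥-elim (ℕₚ.<-irrefl refl (g m<n))
... | tri≈ _ eq _  = eq
... | tri> _ _ n<m = ⊥-elim (ℕₚ.<-irrefl refl (f n<m))

module _ (p : Partition) where

  cell<bound : ∀ {r c} → r < part p c → c < bound p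
  cell<bound {r} {c} lt with c <? bound p
  ... | yes q = q
  ... | no ¬q = contradiction (subst (r <_) (vanishing p c (ℕₚ.≮⇒≥ ¬q)) lt) λ ()

  conjugate⁻ : ∀ {r c} → c < conjugate p r → r < part p c
  conjugate⁻ {r} lt = proj₂ (<length-filter⁻ (λ c → r <? part p c) id (bound p)
                               (λ c lt → ℕₚ.<-≤-trans lt (decreasing p c)) lt)

  conjugate⁺ : ∀ {r c} → r < part p c → c < conjugate p r
  conjugate⁺ {r} lt = <length-filter⁺ (λ c → r <? part p c) id (bound p)
                               (λ c lt → ℕₚ.<-≤-trans lt (decreasing p c)) (cell<bound lt) lt

Symmetric : Partition → Set
Symmetric p = ∀ {r c} → c < part p r → r < part p c

selfConjugate⇒symmetric : ∀ p → SelfConjugate p → Symmetric p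
selfConjugate⇒symmetric p sc {r} {c} lt = conjugate⁻ p (subst (c <_) (sc r) lt)

symmetric⇒selfConjugate : ∀ p → Symmetric p → SelfConjugate p
symmetric⇒selfConjugate p sy r = ≡-by-< (conjugate⁺ p ∘ sy) (sy ∘ conjugate⁻ p)

-- γ is the contents c − r of the last cell of a row, with −r−1 for an empty row r.
record Bead (p : Partition) (γ : ℤ) : Set where
  constructor _at-row_
  field
    row    : ℕ
    end-of : + part p row ≡ γ + + suc row

antipode : ℤ → ℤ
antipode γ = -1ℤ - γ

antipode-involutive : ∀ γ → antipode (antipode γ) ≡ γ
antipode-involutive = lem
  where
  lem : ∀ γ → -1ℤ - (-1ℤ - γ) ≡ γ
  lem = solve-∀

antipode-+ : ∀ n → -[1+ n ] ≡ antipode (+ n)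
antipode-+ zero    = refl
antipode-+ (suc n) = refl

Bead⁺ : ∀ {p n} r → part p r ≡ n ℕ.+ suc r → Bead p (+ n)
Bead⁺ r eq = r at-row cong +_ eq

Bead⁻ : ∀ {p n} r → part p r ℕ.+ n ≡ r → Bead p -[1+ n ]
Bead⁻ {p} {n} r eq = r at-row (begin
  + part p r ≡⟨ lem (+ part p r) (+ n) ⟩
  - (1ℤ + + n) + (1ℤ + (+ part p r + + n)) ≡⟨ cong (λ z → -[1+ n ] + (1ℤ + + z)) eq ⟩
  -[1+ n ] + + suc r ∎)
  where
  open ≡-Reasoning
  lem : ∀ x n → x ≡ - (1ℤ + n) + (1ℤ + (x + n))
  lem = solve-∀

module SymmetricBeads (p : Partition) (sy : Symmetric p) where

  ≤-sym : ∀ {r c} → part p r ≤ c → part p c ≤ r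
  ≤-sym le = ℕₚ.≮⇒≥ (λ lt → ℕₚ.<⇒≱ (sy lt) le)

  -- Walks down the rows while row r ends strictly to the right of the diagonal
  -- n.  By symmetry column n + r then has at least r cells, and at the first row
  -- ending to the left of that diagonal it has exactly r.
  search : ∀ n fuel r → bound p ≤ r ℕ.+ fuel → r ≤ part p (n ℕ.+ r) → Bead p (+ n) ⊎ Bead p -[1+ n ]
  search n fuel r le inv with ℕₚ.<-cmp (part p r) (n ℕ.+ suc r)
  ... | tri≈ _ eq _ = inj₁ (Bead⁺ {p} r eq)
  ... | tri< lt _ _ = inj₂ (Bead⁻ {p} (n ℕ.+ r)
          (trans (cong (ℕ._+ n) (ℕₚ.≤-antisym (≤-sym (ℕ.s≤s⁻¹ (subst (part p r <_) (ℕₚ.+-suc n r) lt))) inv))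
                 (ℕₚ.+-comm r n)))
  search n zero r le inv | tri> _ _ gt =
    contradiction (subst (n ℕ.+ suc r <_) (vanishing p r (subst (bound p ≤_) (ℕₚ.+-identityʳ r) le)) gt) λ ()
  search n (suc fuel) r le inv | tri> _ _ gt =
    search n fuel (suc r) (subst (bound p ≤_) (ℕₚ.+-suc r fuel) le) (sy gt)

  bead-or : ∀ γ → Bead p γ ⊎ Bead p (antipode γ)
  bead-or (+ n) = subst (λ z → Bead p (+ n) ⊎ Bead p z) (antipode-+ n) (search n (bound p) 0 ℕₚ.≤-refl z≤n)
  bead-or -[1+ n ] = subst (λ z → Bead p -[1+ n ] ⊎ Bead p z) (lem n)
                       (swap (search n (bound p) 0 ℕₚ.≤-refl z≤n))
    where
    lem : ∀ n → + n ≡ antipode -[1+ n ]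
    lem zero    = refl
    lem (suc n) = refl

  -- The hook length at (r, c) is the sum of the two parts minus r + c + 1. By symmetry (r, c) and
  -- (c, r) are cells together, so this difference is positive on cells and, by `noncells⇒small`,
  -- negative elsewhere. It is never 0.
  cells⇒large : ∀ r c → c < part p r → suc (suc (r ℕ.+ c)) ≤ part p r ℕ.+ part p c
  cells⇒large r c lt = subst (_≤ part p r ℕ.+ part p c)
    (cong suc (trans (ℕₚ.+-suc c r) (cong suc (ℕₚ.+-comm c r)))) (ℕₚ.+-mono-≤ lt (sy lt))

  noncells⇒small : ∀ r c → part p r ≤ c → part p r ℕ.+ part p c ≤ r ℕ.+ c
  noncells⇒small r c le = subst (part p r ℕ.+ part p c ≤_) (ℕₚ.+-comm c r) (ℕₚ.+-mono-≤ le (≤-sym le))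

  -- No two rows with γ_r + γ_c = −1.
  part-sum≢ : ∀ r c → part p r ℕ.+ part p c ≢ suc (r ℕ.+ c)
  part-sum≢ r c eq with c <? part p r
  ... | yes lt = ℕₚ.<-irrefl refl (ℕₚ.≤-trans (cells⇒large r c lt) (ℕₚ.≤-reflexive eq))
  ... | no ¬lt = ℕₚ.<-irrefl refl (ℕₚ.≤-trans (ℕₚ.≤-reflexive (sym eq)) (noncells⇒small r c (ℕₚ.≮⇒≥ ¬lt)))

  -- The second bead is the antipode of γ - k, and the conclusion says that (r, c) has hook length
  -- `k`. The case k = 0 concerns two antipodal beads.
  beads-sum : ∀ {k} r c γ → + part p r ≡ γ + + suc r → + part p c ≡ (k - 1ℤ - γ) + + suc c →
              + (part p r ℕ.+ part p c) ≡ k + + suc (r ℕ.+ c)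
  beads-sum {k} r c γ e₁ e₂ = trans (cong₂ _+_ e₁ e₂) (lem k γ (+ r) (+ c))
    where
    lem : ∀ k γ r c → (γ + (1ℤ + r)) + ((k - 1ℤ - γ) + (1ℤ + c)) ≡ k + (1ℤ + (r + c))
    lem = solve-∀

  bead-nand : ∀ γ → Bead p γ → ¬ Bead p (antipode γ)
  bead-nand γ (r at-row e₁) (c at-row e₂) = part-sum≢ r c (ℤₚ.+-injective (beads-sum {0ℤ} r c γ e₁ e₂))

  bead? : ∀ γ → Dec (Bead p γ)
  bead? γ with bead-or γ
  ... | inj₁ b = yes b
  ... | inj₂ b = no (λ b′ → bead-nand γ b′ b)

  hook-sum : ∀ r c → conjugate p c ≡ part p c →
             hookLength p r c + + suc (r ℕ.+ c) ≡ + (part p r ℕ.+ part p c)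
  hook-sum r c eq rewrite eq = lem (+ part p r) (+ part p c) (+ r) (+ c)
    where
    lem : ∀ x y r c → (1ℤ + (x - (1ℤ + r)) + (y - (1ℤ + c))) + (1ℤ + (r + c)) ≡ x + y
    lem = solve-∀

  -- A hook of length s at (r, c) means that the bead of row c is the antipode of the bead of row r
  -- lowered by s. Closure would make both of these beads.
  closed⇒core : ∀ s → (∀ γ → Bead p γ → Bead p (γ - + s)) → 𝒞 s p
  closed⇒core s closed r c _ hook = bead-nand (γ - + s) (closed γ (r at-row e₁)) (c at-row e₂)
    where
    open ≡-Reasoning
    x = + part p r
    y = + part p c
    γ = x - + suc r
    e₁ : x ≡ γ + + suc r
    e₁ = lem x (+ suc r)
      where
      lem : ∀ x r → x ≡ (x - r) + r
      lem = solve-∀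
    e₂ : y ≡ antipode (γ - + s) + + suc c
    e₂ = begin
      y ≡⟨ lem₁ x y ⟩
      (x + y) - x
        ≡⟨ cong (_- x) (trans (sym (hook-sum r c (sym (symmetric⇒selfConjugate p sy c))))
             (cong (_+ + suc (r ℕ.+ c)) hook)) ⟩
      (+ s + + suc (r ℕ.+ c)) - x ≡⟨ lem₂ (+ s) x (+ r) (+ c) ⟩
      antipode (γ - + s) + + suc c ∎
      where
      lem₁ : ∀ x y → y ≡ (x + y) - x
      lem₁ = solve-∀
      lem₂ : ∀ s x r c → (s + (1ℤ + (r + c))) - x ≡ (-1ℤ - ((x - (1ℤ + r)) - s)) + (1ℤ + c)
      lem₂ = solve-∀

  -- If γ - s is not a bead, its antipode ends some row c, and (r, c) has hook length s. This is
  -- positive, so (r, c) is a cell, against the core condition.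
  core⇒closed : ∀ s → 𝒞 (suc s) p → ∀ γ → Bead p γ → Bead p (γ - + suc s)
  core⇒closed s core γ (r at-row e₁) with bead-or (γ - + suc s)
  ... | inj₁ b = b
  ... | inj₂ (c at-row e₂) = ⊥-elim (case-cell (c <? part p r))
    where
    total : part p r ℕ.+ part p c ≡ suc s ℕ.+ suc (r ℕ.+ c)
    total = ℤₚ.+-injective (beads-sum {+ suc s} r c γ e₁ (trans e₂ (cong (_+ + suc c) (lem γ (+ suc s)))))
      where
      lem : ∀ γ s → -1ℤ - (γ - s) ≡ s - 1ℤ - γ
      lem = solve-∀
    case-cell : Dec (c < part p r) → ⊥
    case-cell (yes lt) = core r c lt (∙-cancelʳ ℤₚ.+-0-abelianGroup (+ suc (r ℕ.+ c)) _ _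
      (trans (hook-sum r c (sym (symmetric⇒selfConjugate p sy c))) (cong +_ total)))
    case-cell (no ¬lt) = ℕₚ.<-irrefl refl (ℕₚ.≤-trans
      (ℕₚ.≤-trans (s≤s (ℕₚ.≤-trans (ℕₚ.n≤1+n _) (ℕₚ.m≤n+m _ s))) (ℕₚ.≤-reflexive (sym total)))
      (noncells⇒small r c (ℕₚ.≮⇒≥ ¬lt)))

antitone : ∀ {f : ℕ → ℕ} → (∀ r → f (suc r) ≤ f r) → ∀ {r r′} → r ≤ r′ → f r′ ≤ f r
antitone {f} down le = go (ℕₚ.≤⇒≤′ le)
  where
  go : ∀ {r r′} → r ℕ.≤′ r′ → f r′ ≤ f r
  go ℕ.≤′-refl     = ℕₚ.≤-refl
  go (ℕ.≤′-step l) = ℕₚ.≤-trans (down _) (go l)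

-- Row r of p ends on the same diagonal as some row k of q, and k < r would
-- force two rows of p to end on one diagonal.
part-≤ : ∀ {p q} → (∀ γ → Bead p γ → Bead q γ) →
         ∀ r → (∀ k → k < r → part p k ≡ part q k) → part p r ≤ part q r
part-≤ {p} {q} p⊆q r ih = fromRow (p⊆q _ (r at-row lem₁ (+ part p r) (+ suc r)))
  where
  lem₁ : ∀ x y → x ≡ (x - y) + y
  lem₁ = solve-∀
  lem₂ : ∀ x r k → ((x - r) + k) + r ≡ x + k
  lem₂ = solve-∀
  fromRow : Bead q (+ part p r - + suc r) → part p r ≤ part q r
  fromRow (k at-row eq) = [ r≤k-case , k<r-case ]′ (ℕₚ.≤-<-connex r k)
    where
    eq′ : part q k ℕ.+ suc r ≡ part p r ℕ.+ suc k
    eq′ = ℤₚ.+-injective (trans (cong (_+ + suc r) eq) (lem₂ (+ part p r) (+ suc r) (+ suc k)))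
    r≤k-case : r ≤ k → part p r ≤ part q r
    r≤k-case r≤k = ℕₚ.≤-trans
      (ℕₚ.+-cancelʳ-≤ (suc k) _ _ (ℕₚ.≤-trans (ℕₚ.≤-reflexive (sym eq′)) (ℕₚ.+-monoʳ-≤ (part q k) (s≤s r≤k))))
      (antitone (decreasing q) r≤k)
    k<r-case : k < r → part p r ≤ part q r
    k<r-case k<r = ⊥-elim (ℕₚ.<-irrefl (sym eq′)
      (ℕₚ.+-mono-≤-< (ℕₚ.≤-trans (antitone (decreasing p) (ℕₚ.<⇒≤ k<r)) (ℕₚ.≤-reflexive (ih k k<r))) (s≤s k<r)))

beads-determine-parts : ∀ {p q} → (∀ γ → Bead p γ → Bead q γ) → (∀ γ → Bead q γ → Bead p γ) →
                        ∀ r → part p r ≡ part q r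
beads-determine-parts {p} {q} p⊆q q⊆p = <-rec _ λ r ih →
  ℕₚ.≤-antisym (part-≤ {p} {q} p⊆q r (λ k lt → ih lt)) (part-≤ {q} {p} q⊆p r (λ k lt → sym (ih lt)))

-- Self-conjugate partitions with prescribed principal hooks

StrictlyDecreasing : List ℕ → Set
StrictlyDecreasing = AllPairs ℕ._>_

-- The self-conjugate partition whose principal hooks have lengths 2n + 1 for
-- n in D, that is Frobenius coordinates (D | D).
rows : List ℕ → ℕ → ℕ
rows []      _       = 0
rows (n ∷ D) zero    = suc n
rows (n ∷ D) (suc r) with r <? n
... | yes _ = suc (rows D r)
... | no  _ = 0

hookBound : List ℕ → ℕ
hookBound []      = 0
hookBound (n ∷ _) = suc n

rows-vanish : ∀ D r → hookBound D ≤ r → rows D r ≡ 0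
rows-vanish []      r       _        = refl
rows-vanish (n ∷ D) (suc r) (s≤s le) with r <? n
... | yes lt = contradiction lt (ℕₚ.≤⇒≯ le)
... | no  _  = refl

hookBound-tail : ∀ {n D} → StrictlyDecreasing (n ∷ D) → hookBound D ≤ n
hookBound-tail {D = []}    _                = z≤n
hookBound-tail {D = m ∷ D} ((m<n ∷ _) ∷ _) = m<n

rows-≤ : ∀ {D} → StrictlyDecreasing D → ∀ r → rows D r ≤ hookBound D
rows-≤ []       r       = z≤n
rows-≤ (_ ∷ _)  zero    = ℕₚ.≤-refl
rows-≤ {n ∷ D} sd@(_ ∷ sd′) (suc r) with r <? n
... | yes _ = s≤s (ℕₚ.≤-trans (rows-≤ sd′ r) (hookBound-tail sd))
... | no  _ = z≤n

rows-decreasing : ∀ {D} → StrictlyDecreasing D → ∀ r → rows D (suc r) ≤ rows D r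
rows-decreasing []      r    = z≤n
rows-decreasing {n ∷ D} sd zero = rows-≤ sd 1
rows-decreasing {n ∷ D} (_ ∷ sd) (suc r) with suc r <? n | r <? n
... | yes _ | yes _ = s≤s (rows-decreasing sd r)
... | yes p | no ¬q = contradiction (ℕₚ.<-trans (ℕₚ.n<1+n r) p) ¬q
... | no  _ | _     = z≤n

fromHooks : ∀ D → StrictlyDecreasing D → Partition
fromHooks D sd = record
  { part = rows D ; decreasing = rows-decreasing sd ; bound = hookBound D ; vanishing = rows-vanish D }

rows-symmetric : ∀ {D} → StrictlyDecreasing D → ∀ r c → c < rows D r → r < rows D c
rows-symmetric {n ∷ D} sd zero zero lt = lt
rows-symmetric {n ∷ D} sd zero (suc c) (s≤s lt) with c <? n
... | yes _ = s≤s z≤n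
... | no ¬q = contradiction lt ¬q
rows-symmetric {n ∷ D} sd (suc r) zero lt with r <? n
... | yes q = s≤s q
rows-symmetric {n ∷ D} sd@(_ ∷ sd′) (suc r) (suc c) lt with r <? n | c <? n
rows-symmetric {n ∷ D} sd@(_ ∷ sd′) (suc r) (suc c) (s≤s lt) | yes _ | yes _ = s≤s (rows-symmetric sd′ r c lt)
rows-symmetric {n ∷ D} sd@(_ ∷ sd′) (suc r) (suc c) (s≤s lt) | yes _ | no ¬q =
  contradiction (ℕₚ.<-≤-trans lt (ℕₚ.≤-trans (rows-≤ sd′ r) (hookBound-tail sd))) ¬q

rows-suc : ∀ {m r} D → r < m → rows (m ∷ D) (suc r) ≡ suc (rows D r)
rows-suc {m} {r} D lt with r <? m
... | yes _ = refl
... | no ¬q = contradiction lt ¬q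

-- With `rows-hook⁻` this identifies the nonnegative beads of `fromHooks D` with the entries of `D`.
-- Adding an outer hook moves a row of the inner partition one step down and one to the right, which
-- keeps its last cell on the same diagonal.
rows-hook⁺ : ∀ {D} → StrictlyDecreasing D → ∀ {n} → n ∈ D → ∃[ r ] rows D r ≡ n ℕ.+ suc r
rows-hook⁺ {n ∷ D} _ (here refl) = 0 , ℕₚ.+-comm 1 n
rows-hook⁺ {m ∷ D} sd@(_ ∷ sd′) {n} (there n∈D) with rows-hook⁺ sd′ n∈D
... | r , eq = suc r , trans (rows-suc D r<m) (trans (cong suc eq) (sym (ℕₚ.+-suc n (suc r))))
  where
  open ℕₚ.≤-Reasoning
  r<m : r < m
  r<m = begin
    suc r         ≤⟨ ℕₚ.m≤n+m (suc r) n ⟩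
    n ℕ.+ suc r   ≡⟨ eq ⟨
    rows D r      ≤⟨ rows-≤ sd′ r ⟩
    hookBound D   ≤⟨ hookBound-tail sd ⟩
    m             ∎

rows-hook⁻ : ∀ D {n} r → rows D r ≡ n ℕ.+ suc r → n ∈ D
rows-hook⁻ []      {n} r eq = contradiction (trans eq (ℕₚ.+-suc n r)) λ ()
rows-hook⁻ (m ∷ D) {n} zero eq = here (ℕₚ.suc-injective (trans (ℕₚ.+-comm 1 n) (sym eq)))
rows-hook⁻ (m ∷ D) {n} (suc r) eq with r <? m
... | yes _ = there (rows-hook⁻ D r (ℕₚ.suc-injective (trans eq (ℕₚ.+-suc n (suc r)))))
... | no  _ = contradiction (trans eq (ℕₚ.+-suc n (suc r))) λ ()

sum-applyUpTo-∸ : ∀ f m n → m ≤ n → (∀ r → m ≤ r → f r ≡ 0) → sum (applyUpTo f n) ≡ sum (applyUpTo f m)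
sum-applyUpTo-∸ f zero    zero    _        _    = refl
sum-applyUpTo-∸ f zero    (suc n) _        zeros =
  cong₂ ℕ._+_ (zeros 0 z≤n) (sum-applyUpTo-∸ (f ∘ suc) zero n z≤n (λ r _ → zeros (suc r) z≤n))
sum-applyUpTo-∸ f (suc m) (suc n) (s≤s le) zeros =
  cong (f 0 ℕ.+_) (sum-applyUpTo-∸ (f ∘ suc) m n le (λ r m≤r → zeros (suc r) (s≤s m≤r)))

sum-applyUpTo-suc : ∀ f g n → (∀ r → r < n → f r ≡ suc (g r)) →
                    sum (applyUpTo f n) ≡ n ℕ.+ sum (applyUpTo g n)
sum-applyUpTo-suc f g zero    _  = refl
sum-applyUpTo-suc f g (suc n) eq = trans
  (cong₂ ℕ._+_ (eq 0 (s≤s z≤n)) (sum-applyUpTo-suc (f ∘ suc) (g ∘ suc) n (λ r lt → eq (suc r) (s≤s lt))))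
  (cong suc (x∙yz≈y∙xz (g 0) n _))
  where open CommutativeSemigroupₚ ℕₚ.+-commutativeSemigroup using (x∙yz≈y∙xz)

-- The outermost hook consists of the n + 1 cells of the first row and one cell in each of the next
-- n rows. The inner partition has at most n rows, so summing over n of them misses nothing.
sum-rows : ∀ {D} → StrictlyDecreasing D →
           sum (applyUpTo (rows D) (hookBound D)) ≡ sum (map (λ n → suc n ℕ.+ n) D)
sum-rows []                   = refl
sum-rows {n ∷ D} sd@(_ ∷ sd′) = begin
  suc n ℕ.+ sum (applyUpTo (rows (n ∷ D) ∘ suc) n)
    ≡⟨ cong (suc n ℕ.+_) (sum-applyUpTo-suc _ (rows D) n (λ r → rows-suc D)) ⟩
  suc n ℕ.+ (n ℕ.+ sum (applyUpTo (rows D) n))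
    ≡⟨ ℕₚ.+-assoc (suc n) n _ ⟨
  suc n ℕ.+ n ℕ.+ sum (applyUpTo (rows D) n)
    ≡⟨ cong (suc n ℕ.+ n ℕ.+_)
         (trans (sum-applyUpTo-∸ (rows D) (hookBound D) n (hookBound-tail sd) (rows-vanish D)) (sum-rows sd′)) ⟩
  suc n ℕ.+ n ℕ.+ sum (map (λ n → suc n ℕ.+ n) D) ∎
  where open ≡-Reasoning

size-fromHooks : ∀ D sd → size (fromHooks D sd) ≡ sum (map (λ n → suc n ℕ.+ n) D)
size-fromHooks D sd = trans (cong sum (Listₚ.map-upTo (rows D) (hookBound D))) (sum-rows sd)

-- Sums over lists

total : {A : Set} → (A → ℤ) → List A → ℤ
total f []       = 0ℤ
total f (x ∷ xs) = f x + total f xs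

module _ {A : Set} where

  total-++ : ∀ (f : A → ℤ) xs ys → total f (xs ++ ys) ≡ total f xs + total f ys
  total-++ f []       ys = sym (ℤₚ.+-identityˡ _)
  total-++ f (x ∷ xs) ys = trans (cong (_+_ (f x)) (total-++ f xs ys)) (sym (ℤₚ.+-assoc (f x) _ _))

  total-cong : ∀ {f g : A → ℤ} xs → (∀ {x} → x ∈ xs → f x ≡ g x) → total f xs ≡ total g xs
  total-cong []       _  = refl
  total-cong (x ∷ xs) eq = cong₂ _+_ (eq (here refl)) (total-cong xs (eq ∘ there))

  total-map : ∀ {B : Set} (f : B → ℤ) (g : A → B) xs → total f (map g xs) ≡ total (f ∘ g) xs
  total-map f g []       = refl
  total-map f g (x ∷ xs) = cong (_+_ (f (g x))) (total-map f g xs)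

  total-+ : ∀ (f g : A → ℤ) xs → total (λ x → f x + g x) xs ≡ total f xs + total g xs
  total-+ f g []       = refl
  total-+ f g (x ∷ xs) = trans (cong (_+_ (f x + g x)) (total-+ f g xs)) (lem (f x) (g x) _ _)
    where
    lem : ∀ a b c d → (a + b) + (c + d) ≡ (a + c) + (b + d)
    lem = solve-∀

  total-const : ∀ c (xs : List A) → total (λ _ → c) xs ≡ c * + length xs
  total-const c []       = sym (ℤₚ.*-zeroʳ c)
  total-const c (x ∷ xs) = trans (cong (_+_ c) (total-const c xs)) (lem c (+ length xs))
    where
    lem : ∀ c n → c + c * n ≡ c * (1ℤ + n)
    lem = solve-∀

  total-* : ∀ c (f : A → ℤ) xs → total (λ x → c * f x) xs ≡ c * total f xs
  total-* c f []       = sym (ℤₚ.*-zeroʳ c)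
  total-* c f (x ∷ xs) = trans (cong (_+_ (c * f x)) (total-* c f xs)) (sym (ℤₚ.*-distribˡ-+ c (f x) _))

  total-↭ : ∀ (f : A → ℤ) {xs ys} → xs ↭ ys → total f xs ≡ total f ys
  total-↭ f Perm.refl         = refl
  total-↭ f (Perm.prep x p)   = cong (_+_ (f x)) (total-↭ f p)
  total-↭ f (Perm.swap x y p) = trans (lem (f x) (f y) _) (cong (λ z → f y + (f x + z)) (total-↭ f p))
    where
    lem : ∀ a b c → a + (b + c) ≡ b + (a + c)
    lem = solve-∀
  total-↭ f (Perm.trans p q)  = trans (total-↭ f p) (total-↭ f q)

AllPairs-map-∈ : ∀ {A B : Set} {R : A → A → Set} {S : B → B → Set} (f : A → B) {xs} →
  (∀ {x y} → x ∈ xs → y ∈ xs → R x y → S (f x) (f y)) → AllPairs R xs → AllPairs S (map f xs)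
AllPairs-map-∈ f pres []         = []
AllPairs-map-∈ f pres (rs ∷ aps) =
  Allₚ.map⁺ (All.tabulate λ y∈ → pres (here refl) (there y∈) (All.lookup rs y∈)) ∷
  AllPairs-map-∈ f (λ x∈ y∈ → pres (there x∈) (there y∈)) aps

-- The pigeonhole principle for lists: an injection between lists of suitable lengths is a
-- permutation, with no proof of surjectivity.
unique∧⊆⇒↭ : ∀ {A : Set} (xs ys : List A) → Unique xs → (∀ {x} → x ∈ xs → x ∈ ys) →
             length ys ≤ length xs → xs ↭ ys
unique∧⊆⇒↭ []       []       _          _   _  = Perm.refl
unique∧⊆⇒↭ (x ∷ xs) ys (x∉ ∷ uniq) sub le with ∈-∃++ (sub (here refl))
... | ys₁ , ys₂ , refl = Perm.trans
  (Perm.prep x (unique∧⊆⇒↭ xs (ys₁ ++ ys₂) uniq sub′ le′)) (Perm.↭-sym (Permₚ.shift x ys₁ ys₂))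
  where
  le′ : length (ys₁ ++ ys₂) ≤ length xs
  le′ = ℕ.s≤s⁻¹ (ℕₚ.≤-trans (ℕₚ.≤-reflexive (sym (Permₚ.↭-length (Permₚ.shift x ys₁ ys₂)))) le)
  sub′ : ∀ {y} → y ∈ xs → y ∈ ys₁ ++ ys₂
  sub′ y∈ with Permₚ.∈-resp-↭ (Permₚ.shift x ys₁ ys₂) (sub (there y∈))
  ... | here refl = contradiction refl (All.lookup x∉ y∈)
  ... | there y∈′ = y∈′

if-<-yes : ∀ {A : Set} {x y : A} {m n} → m < n → (if m ℕ.<ᵇ n then x else y) ≡ x
if-<-yes {m = m} {n} lt with m ℕ.<ᵇ n | ℕₚ.<⇒<ᵇ lt
... | true | _ = refl

if-<-no : ∀ {A : Set} {x y : A} {m n} → n ≤ m → (if m ℕ.<ᵇ n then x else y) ≡ y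
if-<-no {m = m} {n} le with m ℕ.<ᵇ n in eq
... | false = refl
... | true  = contradiction (ℕₚ.<ᵇ⇒< m n (subst Bool.T (sym eq) _)) (ℕₚ.≤⇒≯ le)

total-upTo-suc : ∀ (f : ℕ → ℤ) n → total f (upTo (suc n)) ≡ f 0 + total (f ∘ suc) (upTo n)
total-upTo-suc f n = cong (_+_ (f 0)) (trans (cong (total f) (sym (Listₚ.map-upTo suc n))) (total-map f suc (upTo n)))

total-below : ∀ (f : ℕ → ℤ) m n → m ≤ n →
              total (λ j → if j ℕ.<ᵇ m then f j else 0ℤ) (upTo n) ≡ total f (upTo m)
total-below f zero n _ = trans (total-const 0ℤ (upTo n)) (ℤₚ.*-zeroˡ (+ length (upTo n)))
total-below f (suc m) (suc n) (s≤s le) = begin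
  total (λ j → if j ℕ.<ᵇ suc m then f j else 0ℤ) (upTo (suc n))
    ≡⟨ total-upTo-suc (λ j → if j ℕ.<ᵇ suc m then f j else 0ℤ) n ⟩
  f 0 + total (λ j → if j ℕ.<ᵇ m then f (suc j) else 0ℤ) (upTo n) ≡⟨ cong (_+_ (f 0)) (total-below (f ∘ suc) m n le) ⟩
  f 0 + total (f ∘ suc) (upTo m) ≡⟨ total-upTo-suc f m ⟨
  total f (upTo (suc m)) ∎
  where open ≡-Reasoning

-- The first m odd numbers add up to m². The constant `c` is arbitrary because shifting the index
-- adds 2 s to it.
total-odd : ∀ s c m → total (λ j → c + s * (+ j + + j + 1ℤ)) (upTo m) ≡ s * + m * + m + c * + m
total-odd s c zero = lem s c
  where
  lem : ∀ s c → 0ℤ ≡ s * 0ℤ * 0ℤ + c * 0ℤ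
  lem = solve-∀
total-odd s c (suc m) = begin
  total (λ j → c + s * (+ j + + j + 1ℤ)) (upTo (suc m)) ≡⟨ total-upTo-suc (λ j → c + s * (+ j + + j + 1ℤ)) m ⟩
  (c + s * (0ℤ + 0ℤ + 1ℤ)) + total (λ j → c + s * (+ suc j + + suc j + 1ℤ)) (upTo m)
    ≡⟨ cong (_+_ (c + s * (0ℤ + 0ℤ + 1ℤ))) (total-cong (upTo m) (λ {j} _ → lem₁ s c (+ j))) ⟩
  (c + s * (0ℤ + 0ℤ + 1ℤ)) + total (λ j → (c + + 2 * s) + s * (+ j + + j + 1ℤ)) (upTo m)
    ≡⟨ cong (_+_ (c + s * (0ℤ + 0ℤ + 1ℤ))) (total-odd s (c + + 2 * s) m) ⟩
  (c + s * (0ℤ + 0ℤ + 1ℤ)) + (s * + m * + m + (c + + 2 * s) * + m) ≡⟨ lem₂ s c (+ m) ⟩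
  s * + suc m * + suc m + c * + suc m ∎
  where
  open ≡-Reasoning
  lem₁ : ∀ s c j → c + s * ((1ℤ + j) + (1ℤ + j) + 1ℤ) ≡ (c + + 2 * s) + s * (j + j + 1ℤ)
  lem₁ = solve-∀
  lem₂ : ∀ s c m → (c + s * (0ℤ + 0ℤ + 1ℤ)) + (s * m * m + (c + + 2 * s) * m) ≡ s * (1ℤ + m) * (1ℤ + m) + c * (1ℤ + m)
  lem₂ = solve-∀

-- The start `u` is arbitrary because dropping the first term turns it into u + 2.
total-squares : ∀ u n → + 3 * total (λ i → (u + + 2 * + i) * (u + + 2 * + i)) (upTo n) ≡
  + n * (+ 3 * u * u + + 6 * u * (+ n - 1ℤ) + + 2 * (+ n - 1ℤ) * (+ 2 * + n - 1ℤ))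
total-squares u zero = lem u
  where
  lem : ∀ u → + 3 * 0ℤ ≡ 0ℤ * (+ 3 * u * u + + 6 * u * (0ℤ - 1ℤ) + + 2 * (0ℤ - 1ℤ) * (+ 2 * 0ℤ - 1ℤ))
  lem = solve-∀
total-squares u (suc n) = begin
  + 3 * total (λ i → (u + + 2 * + i) * (u + + 2 * + i)) (upTo (suc n))
    ≡⟨ cong (_*_ (+ 3)) (total-upTo-suc (λ i → (u + + 2 * + i) * (u + + 2 * + i)) n) ⟩
  + 3 * ((u + + 2 * 0ℤ) * (u + + 2 * 0ℤ) + total (λ i → (u + + 2 * + suc i) * (u + + 2 * + suc i)) (upTo n))
    ≡⟨ cong (λ z → + 3 * ((u + + 2 * 0ℤ) * (u + + 2 * 0ℤ) + z)) (total-cong (upTo n) (λ {i} _ → lem₁ u (+ i))) ⟩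
  + 3 * ((u + + 2 * 0ℤ) * (u + + 2 * 0ℤ) + V)
    ≡⟨ lem₂ u V ⟩
  + 3 * (u * u) + + 3 * V ≡⟨ cong (_+_ (+ 3 * (u * u))) (total-squares (u + + 2) n) ⟩
  _ ≡⟨ lem₃ u (+ n) ⟩
  _ ∎
  where
  open ≡-Reasoning
  V : ℤ
  V = total (λ i → ((u + + 2) + + 2 * + i) * ((u + + 2) + + 2 * + i)) (upTo n)
  lem₁ : ∀ u i → (u + + 2 * (1ℤ + i)) * (u + + 2 * (1ℤ + i)) ≡ ((u + + 2) + + 2 * i) * ((u + + 2) + + 2 * i)
  lem₁ = solve-∀
  lem₂ : ∀ u v → + 3 * ((u + + 2 * 0ℤ) * (u + + 2 * 0ℤ) + v) ≡ + 3 * (u * u) + + 3 * v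
  lem₂ = solve-∀
  lem₃ : ∀ u n → + 3 * (u * u) + n * (+ 3 * (u + + 2) * (u + + 2) + + 6 * (u + + 2) * (n - 1ℤ) + + 2 * (n - 1ℤ) * (+ 2 * n - 1ℤ)) ≡
    (1ℤ + n) * (+ 3 * u * u + + 6 * u * ((1ℤ + n) - 1ℤ) + + 2 * ((1ℤ + n) - 1ℤ) * (+ 2 * (1ℤ + n) - 1ℤ))
  lem₃ = solve-∀

total-cartesianProduct : ∀ {A B : Set} (f : A × B → ℤ) xs ys →
  total f (cartesianProduct xs ys) ≡ total (λ x → total (λ y → f (x , y)) ys) xs
total-cartesianProduct f []       ys = refl
total-cartesianProduct f (x ∷ xs) ys = trans (total-++ f (map (x ,_) ys) (cartesianProduct xs ys))
  (cong₂ _+_ (total-map f (x ,_) ys) (total-cartesianProduct f xs ys))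

-- Partitions in a box

boxes : ℕ → ℕ → List (List ℕ)
boxes zero    b       = [] ∷ []
boxes (suc a) zero    = map (0 ∷_) (boxes a zero)
boxes (suc a) (suc b) = map (suc b ∷_) (boxes a (suc b)) ++ boxes (suc a) b

data InBox : ℕ → ℕ → List ℕ → Set where
  []  : ∀ {b} → InBox 0 b []
  _∷_ : ∀ {a b x g} → x ≤ b → InBox a x g → InBox (suc a) b (x ∷ g)

InBox-mono : ∀ {a b c g} → b ≤ c → InBox a b g → InBox a c g
InBox-mono le []         = []
InBox-mono le (x≤b ∷ ib) = ℕₚ.≤-trans x≤b le ∷ ib

∈-boxes⁻ : ∀ a b {g} → g ∈ boxes a b → InBox a b g
∈-boxes⁻ zero    b       (here refl) = []
∈-boxes⁻ (suc a) zero    g∈ with ∈-map⁻ (0 ∷_) g∈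
... | g′ , g′∈ , refl = z≤n ∷ ∈-boxes⁻ a zero g′∈
∈-boxes⁻ (suc a) (suc b) g∈ with ∈-++⁻ (map (suc b ∷_) (boxes a (suc b))) g∈
... | inj₂ g∈′ = InBox-mono (ℕₚ.n≤1+n b) (∈-boxes⁻ (suc a) b g∈′)
... | inj₁ g∈′ with ∈-map⁻ (suc b ∷_) g∈′
...   | g″ , g″∈ , refl = ℕₚ.≤-refl ∷ ∈-boxes⁻ a (suc b) g″∈

∈-boxes⁺ : ∀ a b {g} → InBox a b g → g ∈ boxes a b
∈-boxes⁺ zero    b       []           = here refl
∈-boxes⁺ (suc a) zero    (z≤n ∷ ib)   = ∈-map⁺ (0 ∷_) (∈-boxes⁺ a zero ib)
∈-boxes⁺ (suc a) (suc b) (x≤ ∷ ib) with ℕₚ.m≤n⇒m<n∨m≡n x≤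
... | inj₁ (s≤s x≤b) = ∈-++⁺ʳ (map (suc b ∷_) (boxes a (suc b))) (∈-boxes⁺ (suc a) b (x≤b ∷ ib))
... | inj₂ refl      = ∈-++⁺ˡ (∈-map⁺ (suc b ∷_) (∈-boxes⁺ a (suc b) ib))

boxes-unique : ∀ a b → Unique (boxes a b)
boxes-unique zero    b       = [] ∷ []
boxes-unique (suc a) zero    = Uniqueₚ.map⁺ Listₚ.∷-injectiveʳ (boxes-unique a zero)
boxes-unique (suc a) (suc b) = Uniqueₚ.++⁺
  (Uniqueₚ.map⁺ Listₚ.∷-injectiveʳ (boxes-unique a (suc b))) (boxes-unique (suc a) b) disjoint
  where
  disjoint : ∀ {g} → ¬ (g ∈ map (suc b ∷_) (boxes a (suc b)) × g ∈ boxes (suc a) b)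
  disjoint (g∈ , g∈′) with ∈-map⁻ (suc b ∷_) g∈ | ∈-boxes⁻ (suc a) b g∈′
  ... | _ , _ , refl | b<b ∷ _ = ℕₚ.<-irrefl refl b<b

at : List ℕ → ℕ → ℕ
at []      _       = 0
at (x ∷ g) zero    = x
at (x ∷ g) (suc i) = at g i

at-≤ : ∀ {a b g} → InBox a b g → ∀ i → at g i ≤ b
at-≤ []         i       = z≤n
at-≤ (x≤b ∷ ib) zero    = x≤b
at-≤ (x≤b ∷ ib) (suc i) = ℕₚ.≤-trans (at-≤ ib i) x≤b

at-decreasing : ∀ {a b g} → InBox a b g → ∀ i → at g (suc i) ≤ at g i
at-decreasing []       i       = z≤n
at-decreasing (_ ∷ ib) zero    = at-≤ ib 0
at-decreasing (_ ∷ ib) (suc i) = at-decreasing ib i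

at-beyond : ∀ {a b g} → InBox a b g → ∀ {i} → a ≤ i → at g i ≡ 0
at-beyond []       _         = refl
at-beyond (_ ∷ ib) (s≤s a≤i) = at-beyond ib a≤i

at-injective : ∀ {a b c g g′} → InBox a b g → InBox a c g′ → (∀ i → i < a → at g i ≡ at g′ i) → g ≡ g′
at-injective []       []        _  = refl
at-injective (_ ∷ ib) (_ ∷ ib′) eq =
  cong₂ _∷_ (eq 0 (s≤s z≤n)) (at-injective ib ib′ (λ i lt → eq (suc i) (s≤s lt)))

at-applyUpTo : ∀ f a {i} → i < a → at (applyUpTo f a) i ≡ f i
at-applyUpTo f (suc a) {zero}  _        = refl
at-applyUpTo f (suc a) {suc i} (s≤s lt) = at-applyUpTo (f ∘ suc) a lt

applyUpTo-inBox : ∀ f a {b} → f 0 ≤ b → (∀ i → suc i < a → f (suc i) ≤ f i) → InBox a b (applyUpTo f a)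
applyUpTo-inBox f zero          _  _    = []
applyUpTo-inBox f (suc zero)    le _    = le ∷ []
applyUpTo-inBox f (suc (suc a)) le down =
  le ∷ applyUpTo-inBox (f ∘ suc) (suc a) (down 0 (s≤s (s≤s z≤n))) (λ i lt → down (suc i) (s≤s lt))

-- Averages over the box

count : ℕ → ℕ → ℕ
count a b = length (boxes a b)

count-step : ∀ a b → count (suc a) (suc b) ≡ count a (suc b) ℕ.+ count (suc a) b
count-step a b = trans (Listₚ.length-++ (map (suc b ∷_) (boxes a (suc b))))
                       (cong (ℕ._+ count (suc a) b) (Listₚ.length-map _ (boxes a (suc b))))

count-zeroʳ : ∀ a → count a 0 ≡ 1
count-zeroʳ zero    = refl
count-zeroʳ (suc a) = trans (Listₚ.length-map _ (boxes a 0)) (count-zeroʳ a)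

-- `count a b` is the binomial coefficient of a + b over a, and this is the ratio of two neighbours
-- in one row of Pascal's triangle. The induction step rests on (a + 1) + (b + 2) = (a + 2) + (b +
-- 1).
count-exchange : ∀ a b → + suc b * + count a (suc b) ≡ + suc a * + count (suc a) b
count-exchange zero zero = refl
count-exchange zero (suc b) rewrite count-step 0 b =
  trans (lem (+ b)) (trans (cong (_+_ 1ℤ) (count-exchange zero b)) (lem′ (+ count 1 b)))
  where
  lem : ∀ b → (1ℤ + (1ℤ + b)) * 1ℤ ≡ 1ℤ + (1ℤ + b) * 1ℤ
  lem = solve-∀
  lem′ : ∀ n → 1ℤ + 1ℤ * n ≡ 1ℤ * (1ℤ + n)
  lem′ = solve-∀
count-exchange (suc a) zero rewrite count-step a 0 | count-zeroʳ (suc (suc a)) | count-zeroʳ (suc a) =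
  trans (lem (+ count a 1))
    (trans (cong (_+ 1ℤ) (trans (count-exchange a zero) (cong (λ n → + suc a * + n) (count-zeroʳ (suc a)))))
           (lem′ (+ a)))
  where
  lem : ∀ n → 1ℤ * (n + 1ℤ) ≡ 1ℤ * n + 1ℤ
  lem = solve-∀
  lem′ : ∀ a → (1ℤ + a) * 1ℤ + 1ℤ ≡ (1ℤ + (1ℤ + a)) * 1ℤ
  lem′ = solve-∀
count-exchange (suc a) (suc b) = begin
  + suc (suc b) * + count (suc a) (suc (suc b))
    ≡⟨ cong (λ n → + suc (suc b) * + n) (count-step a (suc b)) ⟩
  + suc (suc b) * (+ count a (suc (suc b)) + n)
    ≡⟨ ℤₚ.*-distribˡ-+ (+ suc (suc b)) (+ count a (suc (suc b))) n ⟩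
  + suc (suc b) * + count a (suc (suc b)) + + suc (suc b) * n
    ≡⟨ cong (_+ + suc (suc b) * n) (count-exchange a (suc b)) ⟩
  + suc a * n + + suc (suc b) * n
    ≡⟨ lem (+ a) (+ b) n ⟩
  + suc (suc a) * n + + suc b * n
    ≡⟨ cong (_+_ (+ suc (suc a) * n)) (count-exchange (suc a) b) ⟩
  + suc (suc a) * n + + suc (suc a) * + count (suc (suc a)) b
    ≡⟨ ℤₚ.*-distribˡ-+ (+ suc (suc a)) n (+ count (suc (suc a)) b) ⟨
  + suc (suc a) * (n + + count (suc (suc a)) b)
    ≡⟨ cong (λ n → + suc (suc a) * + n) (count-step (suc a) b) ⟨
  + suc (suc a) * + count (suc (suc a)) (suc b) ∎
  where
  open ≡-Reasoning
  n = + count (suc a) (suc b)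
  lem : ∀ a b n → (1ℤ + a) * n + (1ℤ + (1ℤ + b)) * n ≡ (1ℤ + (1ℤ + a)) * n + (1ℤ + b) * n
  lem = solve-∀

module _ (s t : ℤ) where

  term : ℤ → ℤ → ℤ
  term u x = s * x * x + t * u * x

  quad : ℤ → List ℕ → ℤ
  quad u []      = 0ℤ
  quad u (x ∷ g) = term u (+ x) + quad (u + + 2) g

  total-quad-∷ : ∀ u x gs →
    total (quad u) (map (x ∷_) gs) ≡ term u (+ x) * + length gs + total (quad (u + + 2)) gs
  total-quad-∷ u x gs = begin
    total (quad u) (map (x ∷_) gs)                       ≡⟨ total-map (quad u) (x ∷_) gs ⟩
    total (λ g → term u (+ x) + quad (u + + 2) g) gs     ≡⟨ total-+ _ (quad (u + + 2)) gs ⟩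
    total (λ _ → term u (+ x)) gs + total (quad (u + + 2)) gs ≡⟨ cong (_+ total (quad (u + + 2)) gs) (total-const (term u (+ x)) gs) ⟩
    term u (+ x) * + length gs + total (quad (u + + 2)) gs ∎
    where open ≡-Reasoning

  -- Six times the average of `quad u` over the a × b box. The average of Σ g_i² is ab(2b + 1)/6.
  -- The sum Σ (2i + 1) g_i is the sum of the squares of the conjugate parts, so by symmetry its
  -- average is ab(2a + 1)/6. The remaining (u - 1) Σ g_i has average (u - 1)ab/2.
  mean : ℤ → ℤ → ℤ → ℤ
  mean u a b = a * b * (s * (+ 2 * b + 1ℤ) + t * (+ 3 * u + + 2 * a - + 2))

  -- Removing the first row turns u into u + 2, so u varies in the induction. The claims for the two
  -- smaller boxes combine to the claim for the large one up to `K` times the difference of the two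
  -- sides of `count-exchange`; `K` is the cofactor found by comparing the polynomials.
  quad-mean : ∀ u a b → + 6 * total (quad u) (boxes a b) ≡ + count a b * mean u (+ a) (+ b)
  quad-mean u zero b = lem s t u (+ b)
    where
    lem : ∀ s t u b → + 6 * 0ℤ ≡ 1ℤ * (0ℤ * b * (s * (+ 2 * b + 1ℤ) + t * (+ 3 * u + + 2 * 0ℤ - + 2)))
    lem = solve-∀
  quad-mean u (suc a) zero = begin
    + 6 * total (quad u) (boxes (suc a) 0)
      ≡⟨ cong (_*_ (+ 6)) (total-quad-∷ u 0 (boxes a 0)) ⟩
    + 6 * (term u 0ℤ * + count a 0 + total (quad (u + + 2)) (boxes a 0))
      ≡⟨ lem₁ s t u (+ count a 0) _ ⟩
    + 6 * total (quad (u + + 2)) (boxes a 0)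
      ≡⟨ quad-mean (u + + 2) a zero ⟩
    + count a 0 * mean (u + + 2) (+ a) 0ℤ
      ≡⟨ lem₂ s t u (+ a) (+ count a 0) (+ count (suc a) 0) ⟩
    + count (suc a) 0 * mean u (+ suc a) 0ℤ ∎
    where
    open ≡-Reasoning
    lem₁ : ∀ s t u n x → + 6 * ((s * 0ℤ * 0ℤ + t * u * 0ℤ) * n + x) ≡ + 6 * x
    lem₁ = solve-∀
    lem₂ : ∀ s t u a n m →
      n * (a * 0ℤ * (s * (+ 2 * 0ℤ + 1ℤ) + t * (+ 3 * (u + + 2) + + 2 * a - + 2))) ≡
      m * ((1ℤ + a) * 0ℤ * (s * (+ 2 * 0ℤ + 1ℤ) + t * (+ 3 * u + + 2 * (1ℤ + a) - + 2)))
    lem₂ = solve-∀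
  quad-mean u (suc a) (suc b) = begin
    + 6 * total (quad u) (boxes (suc a) (suc b))
      ≡⟨ cong (_*_ (+ 6)) (trans (total-++ (quad u) (map (suc b ∷_) (boxes a (suc b))) (boxes (suc a) b))
           (cong (_+ T₂) (total-quad-∷ u (suc b) (boxes a (suc b))))) ⟩
    + 6 * (term u (+ suc b) * N₁ + T₁ + T₂)
      ≡⟨ lem₁ (term u (+ suc b) * N₁) T₁ T₂ ⟩
    + 6 * (term u (+ suc b) * N₁) + + 6 * T₁ + + 6 * T₂
      ≡⟨ cong₂ (λ x y → + 6 * (term u (+ suc b) * N₁) + x + y) (quad-mean (u + + 2) a (suc b)) (quad-mean u (suc a) b) ⟩
    + 6 * (term u (+ suc b) * N₁) + N₁ * mean (u + + 2) (+ a) (+ suc b) + N₂ * mean u (+ suc a) (+ b)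
      ≡⟨ lem₂ s t u (+ a) (+ b) N₁ N₂ ⟩
    (N₁ + N₂) * mean u (+ suc a) (+ suc b) + K * (+ suc b * N₁ - + suc a * N₂)
      ≡⟨ cong₂ (λ n d → + n * mean u (+ suc a) (+ suc b) + K * d)
           (sym (count-step a b)) (ℤₚ.i≡j⇒i-j≡0 (count-exchange a b)) ⟩
    + count (suc a) (suc b) * mean u (+ suc a) (+ suc b) + K * 0ℤ
      ≡⟨ lem₃ _ K ⟩
    + count (suc a) (suc b) * mean u (+ suc a) (+ suc b) ∎
    where
    open ≡-Reasoning
    N₁ = + count a (suc b)
    N₂ = + count (suc a) b
    T₁ = total (quad (u + + 2)) (boxes a (suc b))
    T₂ = total (quad u) (boxes (suc a) b)
    K  = s * (+ 4 * (1ℤ + + b) - 1ℤ) + t * (+ 3 * u + + 2 * + a)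
    lem₁ : ∀ x y z → + 6 * (x + y + z) ≡ + 6 * x + + 6 * y + + 6 * z
    lem₁ = solve-∀
    lem₂ : ∀ s t u a b n₁ n₂ →
      + 6 * ((s * (1ℤ + b) * (1ℤ + b) + t * u * (1ℤ + b)) * n₁)
        + n₁ * (a * (1ℤ + b) * (s * (+ 2 * (1ℤ + b) + 1ℤ) + t * (+ 3 * (u + + 2) + + 2 * a - + 2)))
        + n₂ * ((1ℤ + a) * b * (s * (+ 2 * b + 1ℤ) + t * (+ 3 * u + + 2 * (1ℤ + a) - + 2))) ≡
      (n₁ + n₂) * ((1ℤ + a) * (1ℤ + b) * (s * (+ 2 * (1ℤ + b) + 1ℤ) + t * (+ 3 * u + + 2 * (1ℤ + a) - + 2)))
        + (s * (+ 4 * (1ℤ + b) - 1ℤ) + t * (+ 3 * u + + 2 * a)) * ((1ℤ + b) * n₁ - (1ℤ + a) * n₂)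
    lem₂ = solve-∀
    lem₃ : ∀ x k → x + k * 0ℤ ≡ x
    lem₃ = solve-∀

quad-total : ∀ {s t a b g} u → InBox a b g →
  quad s t u g ≡ total (λ i → term s t (u + + 2 * + i) (+ at g i)) (upTo a)
quad-total u [] = refl
quad-total {s} {t} {suc a} {g = x ∷ g} u (_ ∷ ib) = begin
  term s t u (+ x) + quad s t (u + + 2) g
    ≡⟨ cong₂ (λ v q → term s t v (+ x) + q) (lem₁ u) (quad-total (u + + 2) ib) ⟩
  term s t (u + + 2 * 0ℤ) (+ x) + total (λ i → term s t ((u + + 2) + + 2 * + i) (+ at g i)) (upTo a)
    ≡⟨ cong (_+_ (term s t (u + + 2 * 0ℤ) (+ x))) (total-cong (upTo a) (λ {i} _ → cong (λ v → term s t v (+ at g i)) (lem₂ u (+ i)))) ⟩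
  term s t (u + + 2 * 0ℤ) (+ x) + total (λ i → term s t (u + + 2 * + suc i) (+ at g i)) (upTo a)
    ≡⟨ total-upTo-suc (λ i → term s t (u + + 2 * + i) (+ at (x ∷ g) i)) a ⟨
  total (λ i → term s t (u + + 2 * + i) (+ at (x ∷ g) i)) (upTo (suc a)) ∎
  where
  open ≡-Reasoning
  lem₁ : ∀ u → u ≡ u + + 2 * 0ℤ
  lem₁ = solve-∀
  lem₂ : ∀ u i → (u + + 2) + + 2 * i ≡ u + + 2 * (1ℤ + i)
  lem₂ = solve-∀

-- Lattice coordinates of beads

by-sign : (P : ℤ → Set) → (∀ n → P (+ n)) → (∀ n → P (antipode (+ n))) → ∀ γ → P γ
by-sign P f g (+ n)      = f n
by-sign P f g -[1+ zero  ] = g 0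
by-sign P f g -[1+ suc n ] = g (suc n)

hookAt : ℤ → ℤ
hookAt γ = 1ℤ + γ + γ

-- The positive part of `hookAt`: a bead contributes a principal hook only if it is nonnegative.
hookAt⁺ : ℤ → ℤ
hookAt⁺ γ@(+ _)    = hookAt γ
hookAt⁺ -[1+ _ ] = 0ℤ

-- As `hookAt` changes sign under `antipode`, this is the decomposition of a number into its
-- positive part minus its negative part.
hookAt-split : ∀ γ → hookAt⁺ γ ≡ hookAt⁺ (antipode γ) + hookAt γ
hookAt-split = by-sign _
  (λ n → subst (λ z → hookAt (+ n) ≡ hookAt⁺ z + hookAt (+ n)) (antipode-+ n) (sym (ℤₚ.+-identityˡ _)))
  λ n → subst₂ (λ y z → hookAt⁺ y ≡ hookAt⁺ z + hookAt (antipode (+ n)))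
          (antipode-+ n) (sym (antipode-involutive (+ n))) (lem (+ n))
  where
  lem : ∀ n → 0ℤ ≡ (1ℤ + n + n) + (1ℤ + (-1ℤ - n) + (-1ℤ - n))
  lem = solve-∀

hookAt⁺-negative : ∀ {γ} → γ ℤ.< 0ℤ → hookAt⁺ γ ≡ 0ℤ
hookAt⁺-negative {+ n}      (+<+ ())
hookAt⁺-negative { -[1+ n ]} _ = refl

nonNegative? : Decidable (λ γ → 0ℤ ℤ.≤ γ)
nonNegative? γ = 0ℤ ℤₚ.≤? γ

total-hookAt⁺ : ∀ γs → total hookAt⁺ γs ≡ total hookAt (filter nonNegative? γs)
total-hookAt⁺ []               = refl
total-hookAt⁺ (+ n ∷ γs)       = cong (_+_ (hookAt (+ n))) (total-hookAt⁺ γs)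
total-hookAt⁺ (-[1+ n ] ∷ γs)  = trans (ℤₚ.+-identityˡ _) (total-hookAt⁺ γs)

pos-sum : ∀ {A : Set} (f : A → ℕ) xs → + sum (map f xs) ≡ total (λ x → + f x) xs
pos-sum f []       = refl
pos-sum f (x ∷ xs) = cong (_+_ (+ f x)) (pos-sum f xs)

residue-unique : ∀ {s i i′} k → i < suc s → i′ < suc s → + i ≡ + i′ + + suc s * k → i ≡ i′
residue-unique {s} {i} {i′} (+ zero) _ _ eq =
  ℤₚ.+-injective (trans eq (trans (cong (_+_ (+ i′)) (ℤₚ.*-zeroʳ (+ suc s))) (ℤₚ.+-identityʳ (+ i′))))
residue-unique {s} {i} {i′} (+ suc k) i<s _ eq =
  contradiction i<s (ℕₚ.≤⇒≯ (ℕₚ.≤-trans (ℕₚ.m≤m*n (suc s) (suc k))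
    (ℕₚ.≤-trans (ℕₚ.m≤n+m _ i′) (ℕₚ.≤-reflexive (sym (ℤₚ.+-injective (trans eq (cong (_+_ (+ i′)) (sym (ℤₚ.pos-* (suc s) (suc k)))))))))))
residue-unique {s} {i} {i′} k@(-[1+ k′ ]) i<s i′<s eq =
  sym (residue-unique (+ suc k′) i′<s i<s (trans (lem (+ i′) (+ suc s * k)) (cong₂ _+_ (sym eq) (ℤₚ.neg-distribʳ-* (+ suc s) k))))
  where
  lem : ∀ x y → x ≡ (x + y) + - y
  lem = solve-∀

≤⇒antipode< : ∀ {i j} → j ℤ.≤ i → antipode i ℤ.< - j
≤⇒antipode< {i} {j} le = ℤₚ.<-≤-trans
  (subst (antipode i ℤ.<_) (ℤₚ.+-identityˡ (- i)) (ℤₚ.+-monoˡ-< (- i) (ℤ.-<+ {0} {0}))) (ℤₚ.neg-mono-≤ le)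

coprime-Bézout-ℤ : ∀ {s t} → Coprime s t → ∃₂ λ x y → + t * x + + s * y ≡ 1ℤ
coprime-Bézout-ℤ {s} {t} c with Coprimality.coprime-Bézout c
... | GCD.Bézout.+- x y eq = - + y , + x , (begin
    + t * - + y + + s * + x ≡⟨ lem (+ t) (+ y) (+ s) (+ x) ⟩
    + x * + s - + y * + t   ≡⟨ cong (_- + y * + t) (trans (sym (ℤₚ.pos-* x s)) (trans (cong +_ (sym eq)) (cong (_+_ 1ℤ) (ℤₚ.pos-* y t)))) ⟩
    (1ℤ + + y * + t) - + y * + t ≡⟨ lem′ (+ y * + t) ⟩
    1ℤ ∎)
  where
  open ≡-Reasoning
  lem : ∀ t y s x → t * - y + s * x ≡ x * s - y * t
  lem = solve-∀
  lem′ : ∀ z → (1ℤ + z) - z ≡ 1ℤ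
  lem′ = solve-∀
... | GCD.Bézout.-+ x y eq = + y , - + x , (begin
    + t * + y + + s * - + x ≡⟨ lem (+ t) (+ y) (+ s) (+ x) ⟩
    + y * + t - + x * + s   ≡⟨ cong (_- + x * + s) (trans (sym (ℤₚ.pos-* y t)) (trans (cong +_ (sym eq)) (cong (_+_ 1ℤ) (ℤₚ.pos-* x s)))) ⟩
    (1ℤ + + x * + s) - + x * + s ≡⟨ lem′ (+ x * + s) ⟩
    1ℤ ∎)
  where
  open ≡-Reasoning
  lem : ∀ t y s x → t * y + s * - x ≡ y * t - x * s
  lem = solve-∀
  lem′ : ∀ z → (1ℤ + z) - z ≡ 1ℤ
  lem′ = solve-∀

-1+i<i : ∀ i → -1ℤ + i ℤ.< i
-1+i<i i = subst (-1ℤ + i ℤ.<_) (ℤₚ.+-identityˡ i) (ℤₚ.+-monoˡ-< i (ℤ.-<+ {0} {0}))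

antipode-injective : ∀ {γ γ′} → antipode γ ≡ antipode γ′ → γ ≡ γ′
antipode-injective {γ} {γ′} eq = trans (sym (antipode-involutive γ)) (trans (cong antipode eq) (antipode-involutive γ′))

∅ : Partition
∅ = fromHooks [] []

∅-symmetric : Symmetric ∅
∅-symmetric ()

∅-bead⁻ : ∀ {γ} → Bead ∅ γ → γ ℤ.< 0ℤ
∅-bead⁻ { + n }      (r at-row eq) = contradiction (trans (ℤₚ.+-injective eq) (ℕₚ.+-suc n r)) λ ()
∅-bead⁻ { -[1+ n ] } _             = -<+

∅-bead⁺ : ∀ {γ} → γ ℤ.< 0ℤ → Bead ∅ γ
∅-bead⁺ { + n }      (+<+ ())
∅-bead⁺ { -[1+ n ] } _ = n at-row sym (ℤₚ.n⊖n≡0 (suc n))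

∅-closed : ∀ k γ → Bead ∅ γ → Bead ∅ (γ - + k)
∅-closed k γ bd = ∅-bead⁺ (ℤₚ.≤-<-trans (ℤₚ.i≤j⇒i-k≤j (+ k) ℤₚ.≤-refl) (∅-bead⁻ bd))

antipode-sign : ∀ {γ} → 0ℤ ℤ.≤ antipode γ → γ ℤ.< 0ℤ
antipode-sign {γ} le = ℤₚ.≰⇒> λ 0≤γ → ℤₚ.<⇒≱ (≤⇒antipode< 0≤γ) le

antipode-negative : ∀ m → antipode (+ m) ℤ.< 0ℤ
antipode-negative m = ≤⇒antipode< {+ m} {0ℤ} (+≤+ z≤n)

halve : ∀ n → ∃[ a ] (n ≡ a ℕ.+ a ⊎ n ≡ suc (a ℕ.+ a))
halve zero    = 0 , inj₁ refl
halve (suc n) with halve n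
... | a , inj₁ eq = a , inj₂ (cong suc eq)
... | a , inj₂ eq = suc a , inj₁ (trans (cong suc eq) (cong suc (sym (ℕₚ.+-suc a a))))

count>0 : ∀ a b → 0 < count a b
count>0 zero    b       = s≤s z≤n
count>0 (suc a) zero    = ℕₚ.≤-reflexive (sym (count-zeroʳ (suc a)))
count>0 (suc a) (suc b) = ℕₚ.≤-trans (count>0 (suc a) b)
  (ℕₚ.≤-trans (ℕₚ.m≤n+m _ (count a (suc b))) (ℕₚ.≤-reflexive (sym (count-step a b))))

/-cross : ∀ x y m n .{{_ : NonZero m}} .{{_ : NonZero n}} → x * + n ≡ y * + m → x / m ≡ y / n
/-cross x y (suc m) (suc n) eq = ℚₚ.fromℚᵘ-cong {mkℚᵘ x m} {mkℚᵘ y n} (*≡* eq)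

sum-ones : ∀ {A : Set} (xs : List A) → sum (map (λ _ → 1) xs) ≡ length xs
sum-ones []       = refl
sum-ones (x ∷ xs) = cong suc (sum-ones xs)

AverageSize : ℕ → ℕ → Set
AverageSize s t =
  Σ[ F ∈ Finite (𝒟 s ∩ 𝒟 t) ]
  Σ[ nz ∈ NonZero (∑ F (λ _ → 1)) ]
    _/_ (+ ∑ F size) (∑ F (λ _ → 1)) {{nz}}
      ≡ ((+ s - 1ℤ) * (+ t - 1ℤ) * (+ s + + t + 1ℤ)) / 24

-- The left side is 24 times the average size: 4 times `mean`, which already carries a factor 6,
-- minus 24 times the constant `base`. With a and b the halves of S and T rounded down, it is a
-- polynomial identity only once the parities are fixed.
MeanIdentity : ℤ → ℤ → ℤ → ℤ → Set
MeanIdentity S T a b =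
  + 4 * mean S T (1ℤ - S) a b + (T * T - 1ℤ) * (S * S - 1ℤ) ≡ (S - 1ℤ) * (T - 1ℤ) * (S + T + 1ℤ)

odd-odd : ∀ a b → MeanIdentity (1ℤ + (a + a)) (1ℤ + (b + b)) a b
odd-odd = lem
  where
  lem : ∀ a b → let S = 1ℤ + (a + a) ; T = 1ℤ + (b + b) in
    + 4 * (a * b * (S * (+ 2 * b + 1ℤ) + T * (+ 3 * (1ℤ - S) + + 2 * a - + 2))) + (T * T - 1ℤ) * (S * S - 1ℤ)
      ≡ (S - 1ℤ) * (T - 1ℤ) * (S + T + 1ℤ)
  lem = solve-∀

odd-even : ∀ a b → MeanIdentity (1ℤ + (a + a)) (b + b) a b
odd-even = lem
  where
  lem : ∀ a b → let S = 1ℤ + (a + a) ; T = b + b in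
    + 4 * (a * b * (S * (+ 2 * b + 1ℤ) + T * (+ 3 * (1ℤ - S) + + 2 * a - + 2))) + (T * T - 1ℤ) * (S * S - 1ℤ)
      ≡ (S - 1ℤ) * (T - 1ℤ) * (S + T + 1ℤ)
  lem = solve-∀

even-odd : ∀ a b → MeanIdentity (a + a) (1ℤ + (b + b)) a b
even-odd = lem
  where
  lem : ∀ a b → let S = a + a ; T = 1ℤ + (b + b) in
    + 4 * (a * b * (S * (+ 2 * b + 1ℤ) + T * (+ 3 * (1ℤ - S) + + 2 * a - + 2))) + (T * T - 1ℤ) * (S * S - 1ℤ)
      ≡ (S - 1ℤ) * (T - 1ℤ) * (S + T + 1ℤ)
  lem = solve-∀

module Lattice (s′ t′ h : ℕ) (coprime : Coprime (suc s′) (suc t′)) (2h≡ : h ℕ.+ h ≡ s′ ℕ.* t′) where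

  s t : ℕ
  s = suc s′
  t = suc t′

  S T H : ℤ
  S = + s
  T = + t
  H = + h

  2H≡ : H + H ≡ + s′ * + t′
  2H≡ = trans (cong +_ 2h≡) (ℤₚ.pos-* s′ t′)

  opaque

    pt : ℤ → ℤ → ℤ
    pt i j = T * i + S * j - H

  -- Ring identities modulo the relation 2h = (s - 1)(t - 1): `k` is the multiple of the relation by
  -- which the two sides differ as polynomials.
  by-2H : ∀ {x y k} → x ≡ y + k * ((H + H) - + s′ * + t′) → x ≡ y
  by-2H {x} {y} {k} eq = trans eq (trans (cong (λ z → y + k * z) (ℤₚ.i≡j⇒i-j≡0 2H≡)) (lem y k))
    where
    lem : ∀ y k → y + k * 0ℤ ≡ y
    lem = solve-∀

  opaque
    unfolding pt

    antipode-pt : ∀ i j → antipode (pt i j) ≡ pt (+ s′ - i) (antipode j)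
    antipode-pt i j = by-2H {k = 1ℤ} (lem (+ s′) (+ t′) H i j)
      where
      lem : ∀ s t h i j → -1ℤ - ((1ℤ + t) * i + (1ℤ + s) * j - h) ≡
            ((1ℤ + t) * (s - i) + (1ℤ + s) * (-1ℤ - j) - h) + 1ℤ * ((h + h) - s * t)
      lem = solve-∀

    -- The same integer as in `antipode-pt`, since `pt` is invariant under (i, j) ↦ (i - s, j + t).
    -- The row leaves the range from 0 to s - 1, but for nonnegative i it lies below i, and the
    -- column t - 1 - j can be compared with j.
    antipode-pt′ : ∀ i j → antipode (pt i j) ≡ pt (antipode i) (+ t′ - j)
    antipode-pt′ i j = by-2H {k = 1ℤ} (lem (+ s′) (+ t′) H i j)
      where
      lem : ∀ s t h i j → -1ℤ - ((1ℤ + t) * i + (1ℤ + s) * j - h) ≡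
            ((1ℤ + t) * (-1ℤ - i) + (1ℤ + s) * (t - j) - h) + 1ℤ * ((h + h) - s * t)
      lem = solve-∀

  opaque

    inverse-t : ℤ
    inverse-t = proj₁ (coprime-Bézout-ℤ {s} {t} coprime)

    inverse-s : ℤ
    inverse-s = proj₁ (proj₂ (coprime-Bézout-ℤ {s} {t} coprime))

    bézout : T * inverse-t + S * inverse-s ≡ 1ℤ
    bézout = proj₂ (proj₂ (coprime-Bézout-ℤ {s} {t} coprime))

  opaque
    unfolding pt

    -- Bézout writes γ + h as a combination of s and t. Reducing the coefficient of t modulo s gives
    -- the row, and the quotient moves into the column because t · (q s) = s · (t q).
    coords : ∀ γ → ∃₂ λ i j → i < s × γ ≡ pt (+ i) j
    coords γ = r , y * w + T * q , ℤDivMod.n%ℕd<d (x * w) s , (begin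
      γ                                   ≡⟨ lem₁ γ H ⟩
      1ℤ * w - H                          ≡⟨ cong (λ z → z * w - H) bézout ⟨
      (T * x + S * y) * w - H             ≡⟨ lem₂ T x S y w H ⟩
      T * (x * w) + S * (y * w) - H       ≡⟨ cong (λ z → T * z + S * (y * w) - H) (ℤDivMod.a≡a%ℕn+[a/ℕn]*n (x * w) s) ⟩
      T * (+ r + q * S) + S * (y * w) - H ≡⟨ lem₃ T (+ r) q S (y * w) H ⟩
      T * + r + S * (y * w + T * q) - H   ∎)
      where
      open ≡-Reasoning
      x y w q : ℤ
      x = inverse-t
      y = inverse-s
      w = γ + H
      q = (x * w) /ℕ s
      r : ℕ
      r = (x * w) %ℕ s
      lem₁ : ∀ γ h → γ ≡ 1ℤ * (γ + h) - h
      lem₁ = solve-∀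
      lem₂ : ∀ t x s y w h → (t * x + s * y) * w - h ≡ t * (x * w) + s * (y * w) - h
      lem₂ = solve-∀
      lem₃ : ∀ t r q s z h → t * (r + q * s) + s * z - h ≡ t * r + s * (z + t * q) - h
      lem₃ = solve-∀

    coords-unique : ∀ {i i′ j j′} → i < s → i′ < s → pt (+ i) j ≡ pt (+ i′) j′ → i ≡ i′ × j ≡ j′
    coords-unique {i} {i′} {j} {j′} i<s i′<s eq = i≡i′ , ℤₚ.*-cancelˡ-≡ S j j′ (begin
        S * j                         ≡⟨ lem₁ T S H (+ i) j ⟩
        pt (+ i) j - (T * + i - H)    ≡⟨ cong₂ (λ z k → z - (T * + k - H)) eq i≡i′ ⟩
        pt (+ i′) j′ - (T * + i′ - H) ≡⟨ lem₁ T S H (+ i′) j′ ⟨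
        S * j′ ∎)
      where
      open ≡-Reasoning
      x y k : ℤ
      -- Multiplying the difference of the two points by the inverse `x` of t modulo s shows that
      -- the rows are congruent; `k` is the resulting quotient.
      x = inverse-t
      y = inverse-s
      k = x * (j′ - j) + y * (+ i - + i′)
      lem₁ : ∀ t s h i j → s * j ≡ (t * i + s * j - h) - (t * i - h)
      lem₁ = solve-∀
      lem₂ : ∀ t s h x y i i′ j j′ →
        (t * x + s * y) * i ≡ (t * x + s * y) * i′ + s * (x * (j′ - j) + y * (i - i′))
          + x * ((t * i + s * j - h) - (t * i′ + s * j′ - h))
      lem₂ = solve-∀
      lem₃ : ∀ i z x → 1ℤ * i + z + x * 0ℤ ≡ i + z
      lem₃ = solve-∀
      i≡i′ : i ≡ i′
      i≡i′ = residue-unique k i<s i′<s (begin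
        + i                           ≡⟨ ℤₚ.*-identityˡ (+ i) ⟨
        1ℤ * + i                      ≡⟨ cong (_* + i) bézout ⟨
        (T * x + S * y) * + i         ≡⟨ lem₂ T S H x y (+ i) (+ i′) j j′ ⟩
        (T * x + S * y) * + i′ + S * k + x * (pt (+ i) j - pt (+ i′) j′)
                                      ≡⟨ cong₂ (λ e d → e * + i′ + S * k + x * d) bézout (ℤₚ.i≡j⇒i-j≡0 eq) ⟩
        1ℤ * + i′ + S * k + x * 0ℤ    ≡⟨ lem₃ (+ i′) (S * k) x ⟩
        + i′ + S * k ∎)

  flipRow : ∀ {i} → i < s → + (s′ ℕ.∸ i) ≡ + s′ - + i
  flipRow {i} i<s = trans (sym (ℤₚ.⊖-≥ (ℕ.s≤s⁻¹ i<s))) (sym (ℤₚ.m-n≡m⊖n s′ i))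

  flipRow<s : ∀ i → s′ ℕ.∸ i < s
  flipRow<s i = s≤s (ℕₚ.m∸n≤m s′ i)

  antipode-row : ∀ {i} j → i < s → antipode (pt (+ i) j) ≡ pt (+ (s′ ℕ.∸ i)) (antipode j)
  antipode-row {i} j i<s = trans (antipode-pt (+ i) j) (cong (λ z → pt z (antipode j)) (sym (flipRow i<s)))

  opaque

    rowOf : ℤ → ℕ
    rowOf γ = proj₁ (coords γ)

    colOf : ℤ → ℤ
    colOf γ = proj₁ (proj₂ (coords γ))

    rowOf<s : ∀ γ → rowOf γ < s
    rowOf<s γ = proj₁ (proj₂ (proj₂ (coords γ)))

    pt-coords : ∀ γ → γ ≡ pt (+ rowOf γ) (colOf γ)
    pt-coords γ = proj₂ (proj₂ (proj₂ (coords γ)))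

  rowOf-pt : ∀ {i} j → i < s → i ≡ rowOf (pt (+ i) j) × j ≡ colOf (pt (+ i) j)
  rowOf-pt j i<s = coords-unique i<s (rowOf<s _) (pt-coords _)

  by-coords : (P : ℤ → Set) → (∀ i j → i < s → P (pt (+ i) j)) → ∀ γ → P γ
  by-coords P f γ = subst P (sym (pt-coords γ)) (f (rowOf γ) (colOf γ) (rowOf<s γ))

  opaque
    unfolding pt

    pt-S : ∀ i j → pt i (-1ℤ + j) ≡ pt i j - S
    pt-S i j = lem T S H i j
      where
      lem : ∀ t s h i j → t * i + s * (-1ℤ + j) - h ≡ (t * i + s * j - h) - s
      lem = solve-∀

    pt-T : ∀ i j → pt (-1ℤ + i) j ≡ pt i j - T
    pt-T i j = lem T S H i j
      where
      lem : ∀ t s h i j → t * (-1ℤ + i) + s * j - h ≡ (t * i + s * j - h) - t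
      lem = solve-∀

    pt-T-wrap : ∀ j → pt (+ s′) (j - T) ≡ pt 0ℤ j - T
    pt-T-wrap j = lem T (+ s′) H j
      where
      lem : ∀ t s h j → t * s + (1ℤ + s) * (j - t) - h ≡ (t * 0ℤ + (1ℤ + s) * j - h) - t
      lem = solve-∀

  -- The antisymmetric extension of g, which is meant to vanish in the rows i
  -- with 2 i + 1 ≥ s, to all s rows.
  threshold : List ℕ → ℕ → ℤ
  threshold g i = + at g i - + at g (s′ ℕ.∸ i)

  -- The intended bead set of the core that `g` encodes, as a set of integers. Its behaviour under
  -- the antipode and its closures are proved before any partition is attached to it.
  X : List ℕ → ℤ → Set
  X g γ = colOf γ ℤ.< threshold g (rowOf γ)

  X? : ∀ g γ → Dec (X g γ)
  X? g γ = colOf γ ℤₚ.<? threshold g (rowOf γ)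

  module _ (g : List ℕ) where

    X-pt⁻ : ∀ {i j} → i < s → X g (pt (+ i) j) → j ℤ.< threshold g i
    X-pt⁻ {i} {j} i<s = let i≡ , j≡ = rowOf-pt j i<s in
      subst₂ ℤ._<_ (sym j≡) (cong (threshold g) (sym i≡))

    X-pt⁺ : ∀ {i j} → i < s → j ℤ.< threshold g i → X g (pt (+ i) j)
    X-pt⁺ {i} {j} i<s = let i≡ , j≡ = rowOf-pt j i<s in
      subst₂ ℤ._<_ j≡ (cong (threshold g) i≡)

    threshold-flip : ∀ {i} → i < s → threshold g (s′ ℕ.∸ i) ≡ - threshold g i
    threshold-flip {i} i<s = trans (cong (λ k → + at g (s′ ℕ.∸ i) - + at g k) (ℕₚ.m∸[m∸n]≡n (ℕ.s≤s⁻¹ i<s)))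
                                   (lem (+ at g (s′ ℕ.∸ i)) (+ at g i))
      where
      lem : ∀ x y → x - y ≡ - (y - x)
      lem = solve-∀

    -- Negating j < G i gives -1 - j < - G i, and the right side is the threshold of the mirrored
    -- row. So antisymmetry makes `X` choose exactly one point of each antipodal pair.
    X-or : ∀ γ → X g γ ⊎ X g (antipode γ)
    X-or = by-coords _ λ i j i<s → case (j ℤₚ.<? threshold g i) of λ where
      (yes lt) → inj₁ (X-pt⁺ i<s lt)
      (no ≮)   → inj₂ (subst (X g) (sym (antipode-row j i<s)) (X-pt⁺ (flipRow<s i)
        (subst (antipode j ℤ.<_) (sym (threshold-flip i<s)) (≤⇒antipode< (ℤₚ.≮⇒≥ ≮)))))

    X-nand : ∀ γ → X g γ → ¬ X g (antipode γ)
    X-nand = by-coords _ λ i j i<s x y → ℤₚ.<⇒≱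
      (subst (antipode j ℤ.<_) (threshold-flip i<s) (X-pt⁻ (flipRow<s i) (subst (X g) (antipode-row j i<s) y)))
      (subst (- threshold g i ℤ.≤_) (lem j) (ℤₚ.neg-mono-≤ (ℤₚ.i<j⇒suc[i]≤j (X-pt⁻ i<s x))))
      where
      lem : ∀ j → - (1ℤ + j) ≡ -1ℤ - j
      lem = solve-∀

    X-closed-s : ∀ γ → X g γ → X g (γ - S)
    X-closed-s = by-coords (λ γ → X g γ → X g (γ - S)) λ i j i<s x → subst (X g) (pt-S (+ i) j)
      (X-pt⁺ {i} { -1ℤ + j} i<s (ℤₚ.<-trans (-1+i<i j) (X-pt⁻ {i} {j} i<s x)))

    module _ {a b} (ib : InBox a b g) (2b≤t : b ℕ.+ b ≤ t) where

      threshold-decreasing : ∀ i → threshold g (suc i) ℤ.≤ threshold g i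
      threshold-decreasing i = ℤₚ.+-mono-≤ (+≤+ (at-decreasing ib i))
        (ℤₚ.neg-mono-≤ (+≤+ (antitone (at-decreasing ib) (ℕₚ.∸-monoʳ-≤ s′ (ℕₚ.n≤1+n i)))))

      -- By antisymmetry the last threshold is the negative of the first, so the claim is that twice
      -- the first is at most t. This is where 2b ≤ t enters.
      threshold-wrap : threshold g 0 ℤ.≤ threshold g s′ + T
      threshold-wrap rewrite ℕₚ.n∸n≡0 s′ = begin
        x - y             ≡⟨ lem x y ⟩
        (x + x) - (x + y) ≤⟨ ℤₚ.+-monoˡ-≤ (- (x + y)) (+≤+ 2g≤t) ⟩
        T - (x + y)       ≤⟨ ℤₚ.i≤i+j (T - (x + y)) (y + y) ⟩
        T - (x + y) + (y + y) ≡⟨ lem′ x y T ⟩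
        (y - x) + T       ∎
        where
        open ℤₚ.≤-Reasoning
        x = + at g 0
        y = + at g s′
        2g≤t : at g 0 ℕ.+ at g 0 ≤ t
        2g≤t = ℕₚ.≤-trans (ℕₚ.+-mono-≤ (at-≤ ib 0) (at-≤ ib 0)) 2b≤t
        lem : ∀ x y → x - y ≡ (x + x) - (x + y)
        lem = solve-∀
        lem′ : ∀ x y t → t - (x + y) + (y + y) ≡ (y - x) + t
        lem′ = solve-∀

      X-closed-t : ∀ γ → X g γ → X g (γ - T)
      X-closed-t = by-coords _ step
        where
        lem : ∀ x t → (x + t) - t ≡ x
        lem = solve-∀
        step : ∀ i j → i < s → X g (pt (+ i) j) → X g (pt (+ i) j - T)
        step (suc i) j i<s x = subst (X g) (pt-T (+ suc i) j)
          (X-pt⁺ (ℕₚ.<-trans (ℕₚ.n<1+n i) i<s) (ℤₚ.<-≤-trans (X-pt⁻ i<s x) (threshold-decreasing i)))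
        step zero    j i<s x = subst (X g) (pt-T-wrap j)
          (X-pt⁺ (ℕₚ.n<1+n s′) (subst (j - T ℤ.<_) (lem (threshold g s′) T)
            (ℤₚ.+-monoˡ-< (- T) (ℤₚ.<-≤-trans (X-pt⁻ i<s x) threshold-wrap))))

  -- From partitions in the box to simultaneous cores

  module Cores (a b : ℕ) (2a≤s : a ℕ.+ a ≤ s) (s≤1+2a : s ≤ suc (a ℕ.+ a))
               (2b≤t : b ℕ.+ b ≤ t) (t≤1+2b : t ≤ suc (b ℕ.+ b)) where

    -- Mirroring moves the rows below `a` out of the support of `g`, so at most one of the two terms
    -- of `threshold` is nonzero, except in the middle row of an odd s, where they cancel.
    flipRow-upper : ∀ {i} → i < a → a ≤ s′ ℕ.∸ i
    flipRow-upper {i} i<a = ℕₚ.m+n≤o⇒m≤o∸n a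
      (ℕ.s≤s⁻¹ (ℕₚ.≤-trans (ℕₚ.≤-reflexive (sym (ℕₚ.+-suc a i))) (ℕₚ.≤-trans (ℕₚ.+-monoʳ-≤ a i<a) 2a≤s)))

    upper<s : ∀ {i} → i < a → i < s
    upper<s i<a = ℕₚ.<-≤-trans i<a (ℕₚ.≤-trans (ℕₚ.m≤m+n a a) 2a≤s)

    threshold-upper : ∀ {c g i} → InBox a c g → i < a → threshold g i ≡ + at g i
    threshold-upper {g = g} {i} ib i<a = trans (cong (λ k → + at g i - + k) (at-beyond ib (flipRow-upper i<a)))
                                               (ℤₚ.+-identityʳ (+ at g i))

    threshold-lower : ∀ {c g i} → InBox a c g → a ≤ i → threshold g i ≡ - + at g (s′ ℕ.∸ i)
    threshold-lower {g = g} {i} ib a≤i = trans (cong (λ k → + k - + at g (s′ ℕ.∸ i)) (at-beyond ib a≤i))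
                                               (ℤₚ.+-identityˡ _)

    threshold≤b : ∀ {g} → InBox a b g → ∀ i → threshold g i ℤ.≤ + b
    threshold≤b {g} ib i = ℤₚ.i≤j⇒i-k≤j (+ at g (s′ ℕ.∸ i)) (+≤+ (at-≤ ib i))

    -- A crude bound for the elements of `X g`, which makes the search for nonnegative beads finite.
    hookLimit : ℕ
    hookLimit = t ℕ.* s ℕ.+ s ℕ.* b

    opaque
      unfolding pt

      pt-bounded : ∀ i j → i < s → j ℤ.< + b → pt (+ i) j ℤ.< + hookLimit
      pt-bounded i j i<s j<b = begin-strict
        T * + i + S * j - H ≤⟨ ℤₚ.i≤j⇒i-k≤j H ℤₚ.≤-refl ⟩
        T * + i + S * j     <⟨ ℤₚ.+-mono-<-≤ (ℤₚ.*-monoˡ-<-pos T (+<+ i<s)) (ℤₚ.*-monoˡ-≤-nonNeg S (ℤₚ.<⇒≤ j<b)) ⟩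
        T * S + S * + b     ≡⟨ cong₂ _+_ (sym (ℤₚ.pos-* t s)) (sym (ℤₚ.pos-* s b)) ⟩
        + hookLimit         ∎
        where open ℤₚ.≤-Reasoning

    X-bounded : ∀ {g n} → InBox a b g → X g (+ n) → n < hookLimit
    X-bounded {g} {n} ib x = ℤₚ.drop‿+<+ (subst (ℤ._< + hookLimit) (sym (pt-coords (+ n)))
      (pt-bounded _ _ (rowOf<s (+ n)) (ℤₚ.<-≤-trans x (threshold≤b ib (rowOf (+ n))))))

    hooks : List ℕ → List ℕ
    hooks g = filter (λ n → X? g (+ n)) (downFrom hookLimit)

    hooks-decreasing : ∀ g → StrictlyDecreasing (hooks g)
    hooks-decreasing g = AllPairsₚ.filter⁺ (λ n → X? g (+ n)) (AllPairsₚ.applyDownFrom⁺₁ id hookLimit (λ j<i _ → j<i))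

    toPartition : List ℕ → Partition
    toPartition g = fromHooks (hooks g) (hooks-decreasing g)

    toPartition-symmetric : ∀ g → Symmetric (toPartition g)
    toPartition-symmetric g = rows-symmetric (hooks-decreasing g) _ _

    module _ {g} (ib : InBox a b g) where

      open SymmetricBeads (toPartition g) (toPartition-symmetric g)

      X⇒bead⁺ : ∀ n → X g (+ n) → Bead (toPartition g) (+ n)
      X⇒bead⁺ n x = let r , eq = rows-hook⁺ (hooks-decreasing g)
                                   (∈-filter⁺ (λ n → X? g (+ n)) (∈-downFrom⁺ (X-bounded ib x)) x)
                    in Bead⁺ {toPartition g} r eq

      bead⁺⇒X : ∀ n → Bead (toPartition g) (+ n) → X g (+ n)
      bead⁺⇒X n (r at-row eq) = proj₂ (∈-filter⁻ (λ n → X? g (+ n)) {xs = downFrom hookLimit}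
                                   (rows-hook⁻ (hooks g) r (ℤₚ.+-injective eq)))

      -- The construction from hooks controls only the nonnegative beads. Both sets contain exactly
      -- one of γ and -1 - γ, so agreement there decides the negative integers as well.
      X⇒bead : ∀ γ → X g γ → Bead (toPartition g) γ
      X⇒bead = by-sign _ X⇒bead⁺ λ n x →
        [ (λ bd → contradiction x (X-nand g (+ n) (bead⁺⇒X n bd))) , id ]′ (bead-or (+ n))

      bead⇒X : ∀ γ → Bead (toPartition g) γ → X g γ
      bead⇒X = by-sign _ bead⁺⇒X λ n bd →
        [ (λ x → contradiction bd (bead-nand (+ n) (X⇒bead⁺ n x))) , id ]′ (X-or g (+ n))

      toPartition-sound : 𝒟 s (toPartition g) × 𝒟 t (toPartition g)
      toPartition-sound =
        (sc , closed⇒core s (λ γ → X⇒bead (γ - S) ∘ X-closed-s g γ ∘ bead⇒X γ)) ,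
        (sc , closed⇒core t (λ γ → X⇒bead (γ - T) ∘ X-closed-t g ib 2b≤t γ ∘ bead⇒X γ))
        where sc = symmetric⇒selfConjugate (toPartition g) (toPartition-symmetric g)

    bead-resp : ∀ {p q} → (∀ r → part p r ≡ part q r) → ∀ {γ} → Bead p γ → Bead q γ
    bead-resp eq (r at-row e) = r at-row (trans (cong +_ (sym (eq r))) e)

    toPartition-injective : ∀ {g g′} → InBox a b g → InBox a b g′ →
      (∀ r → part (toPartition g) r ≡ part (toPartition g′) r) → g ≡ g′
    toPartition-injective {g} {g′} ib ib′ eq = at-injective ib ib′ λ i i<a →
      ≡-by-< (transfer ib ib′ eq i<a) (transfer ib′ ib (sym ∘ eq) i<a)
      where
      transfer : ∀ {g g′} → InBox a b g → InBox a b g′ →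
        (∀ r → part (toPartition g) r ≡ part (toPartition g′) r) →
        ∀ {i} → i < a → ∀ {j} → j < at g i → j < at g′ i
      transfer {g} {g′} ib ib′ eq {i} i<a {j} lt = ℤₚ.drop‿+<+
        (subst (+ j ℤ.<_) (threshold-upper ib′ i<a) (X-pt⁻ g′ (upper<s i<a)
          (bead⇒X ib′ _ (bead-resp {toPartition g} {toPartition g′} eq (X⇒bead ib _
            (X-pt⁺ g (upper<s i<a) (subst (+ j ℤ.<_) (sym (threshold-upper ib i<a)) (+<+ lt))))))))

    -- Every simultaneous core comes from the box

    module Completeness (p : Partition) (sy : Symmetric p)
                        (closed-s : ∀ γ → Bead p γ → Bead p (γ - S))
                        (closed-t : ∀ γ → Bead p γ → Bead p (γ - T)) where

      open SymmetricBeads p sy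

      descend-S : ∀ k i j → Bead p (pt i (+ k + j)) → Bead p (pt i j)
      descend-S zero    i j bd = subst (λ z → Bead p (pt i z)) (ℤₚ.+-identityˡ j) bd
      descend-S (suc k) i j bd = descend-S k i j
        (subst (Bead p) (trans (sym (pt-S i _)) (cong (pt i) (lem (+ k) j))) (closed-s _ bd))
        where
        lem : ∀ k j → -1ℤ + (1ℤ + k + j) ≡ k + j
        lem = solve-∀

      descend-T : ∀ k i j → Bead p (pt (+ k + i) j) → Bead p (pt i j)
      descend-T zero    i j bd = subst (λ z → Bead p (pt z j)) (ℤₚ.+-identityˡ i) bd
      descend-T (suc k) i j bd = descend-T k i j
        (subst (Bead p) (trans (sym (pt-T _ j)) (cong (λ z → pt z j) (lem (+ k) i))) (closed-t _ bd))
        where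
        lem : ∀ k i → -1ℤ + (1ℤ + k + i) ≡ k + i
        lem = solve-∀

      -- The two closures make the bead set a down-set for the product order on coordinates. The
      -- rows are arbitrary integers here, which allows comparisons with points in the form of
      -- `antipode-pt′`.
      descend : ∀ {i i′ j j′} → i′ ℤ.≤ i → j′ ℤ.≤ j → Bead p (pt i j) → Bead p (pt i′ j′)
      descend {i} {i′} {j} {j′} le le′ bd = descend-S ℤ.∣ j - j′ ∣ i′ j′ (descend-T ℤ.∣ i - i′ ∣ i′ _
        (subst₂ (λ x y → Bead p (pt x y)) (lem le) (lem le′) bd))
        where
        lem′ : ∀ i i′ → i ≡ i - i′ + i′
        lem′ = solve-∀
        lem : ∀ {i i′} → i′ ℤ.≤ i → i ≡ + ℤ.∣ i - i′ ∣ + i′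
        lem {i} {i′} le = trans (lem′ i i′) (cong (_+ i′) (sym (ℤₚ.0≤i⇒+∣i∣≡i (ℤₚ.i≤j⇒0≤j-i le))))

      Cell : ℕ → ℕ → Set
      Cell i j = Bead p (pt (+ i) (+ j))

      cell? : ∀ i j → Dec (Cell i j)
      cell? i j = bead? (pt (+ i) (+ j))

      cell-down : ∀ i j → Cell i (suc j) → Cell i j
      cell-down i j = descend-S 1 (+ i) (+ j)

      -- The cut at `b` loses no cells, by `upper-cell<b`.
      rowLength : ℕ → ℕ
      rowLength i = length (filter (cell? i) (upTo b))

      rowLength⁻ : ∀ {i j} → j < rowLength i → j < b × Cell i j
      rowLength⁻ {i} = <length-filter⁻ (cell? i) id b (cell-down i)

      rowLength⁺ : ∀ {i j} → j < b → Cell i j → j < rowLength i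
      rowLength⁺ {i} = <length-filter⁺ (cell? i) id b (cell-down i)

      shape : List ℕ
      shape = applyUpTo rowLength a

      shape-inBox : InBox a b shape
      shape-inBox = applyUpTo-inBox rowLength a
        (ℕₚ.≤-trans (Listₚ.length-filter (cell? 0) (upTo b)) (ℕₚ.≤-reflexive (Listₚ.length-upTo b)))
        λ i _ → ℕₚ.≮⇒≥ λ lt → let j<b , cell = rowLength⁻ {suc i} lt in
          ℕₚ.<-irrefl refl (rowLength⁺ {i} j<b (descend-T 1 (+ i) _ cell))

      nonneg⇒antipode≤ : ∀ m n → antipode (+ m) ℤ.≤ + n
      nonneg⇒antipode≤ zero    n = ℤ.-≤+
      nonneg⇒antipode≤ (suc m) n = ℤ.-≤+

      -- If γ is not a bead, then its antipode is, and closure leads from there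
      -- back to γ.
      upper-negative : ∀ i m → i < a → Bead p (pt (+ i) (antipode (+ m)))
      upper-negative i m i<a = [ id , fromAntipode ]′ (bead-or (pt (+ i) (antipode (+ m))))
        where
        i≤flip : i ≤ s′ ℕ.∸ i
        i≤flip = ℕₚ.≤-trans (ℕₚ.<⇒≤ i<a) (flipRow-upper i<a)
        fromAntipode : Bead p (antipode (pt (+ i) (antipode (+ m)))) → Bead p (pt (+ i) (antipode (+ m)))
        fromAntipode bd = descend (+≤+ i≤flip) (nonneg⇒antipode≤ m m)
          (subst (Bead p) (trans (antipode-row (antipode (+ m)) (upper<s i<a)) (cong (pt _) (antipode-involutive (+ m)))) bd)

      -- If m ≥ b, then t - 1 - m ≤ m because t ≤ 2b + 1. Closure then leads from the cell down to
      -- its own antipode in the form of `antipode-pt′`, and two antipodal beads are impossible.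
      upper-cell<b : ∀ i m → Cell i m → m < b
      upper-cell<b i m cell with m <? b
      ... | yes lt = lt
      ... | no ≮ = contradiction
        (subst (Bead p) (sym (antipode-pt′ (+ i) (+ m))) (descend (nonneg⇒antipode≤ i i) t′-m≤m cell))
        (bead-nand _ cell)
        where
        t′≤m+m : t′ ≤ m ℕ.+ m
        t′≤m+m = ℕₚ.≤-trans (ℕ.s≤s⁻¹ t≤1+2b) (ℕₚ.+-mono-≤ (ℕₚ.≮⇒≥ ≮) (ℕₚ.≮⇒≥ ≮))
        lem : ∀ m → m + m - m ≡ m
        lem = solve-∀
        t′-m≤m : + t′ - + m ℤ.≤ + m
        t′-m≤m = subst (+ t′ - + m ℤ.≤_) (lem (+ m)) (ℤₚ.+-monoˡ-≤ (- + m) (+≤+ t′≤m+m))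

      -- The lemma is applied to rows i ≥ a. Then i is the middle row of an odd s, which is its own
      -- mirror image, and the point with column -1 - m is reached from the cell by descent.
      middle-negative : ∀ {i} → i < s → ∀ m → a ≤ s′ ℕ.∸ i → Cell (s′ ℕ.∸ i) m → Bead p (pt (+ i) (antipode (+ m)))
      middle-negative {i} i<s m a≤i′ = descend (+≤+ i≤i′) (nonneg⇒antipode≤ m m)
        where
        open ℕₚ.≤-Reasoning
        i≤i′ : i ≤ s′ ℕ.∸ i
        i≤i′ = begin
          i                   ≡⟨ ℕₚ.m∸[m∸n]≡n (ℕ.s≤s⁻¹ i<s) ⟨
          s′ ℕ.∸ (s′ ℕ.∸ i)   ≤⟨ ℕₚ.∸-mono (ℕ.s≤s⁻¹ s≤1+2a) a≤i′ ⟩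
          a ℕ.+ a ℕ.∸ a       ≡⟨ ℕₚ.m+n∸n≡m a a ⟩
          a                   ≤⟨ a≤i′ ⟩
          s′ ℕ.∸ i            ∎

      -- In a row from `a` on, a point of `X` that is not a bead has its antipode in the mirrored
      -- row as a bead, and this is a cell. If the mirrored row is below `a`, then `shape` counts
      -- this cell, which contradicts the threshold; otherwise the row is the middle one.
      X⇒bead-row : ∀ i j → i < s → X shape (pt (+ i) j) → Bead p (pt (+ i) j)
      X⇒bead-row i j i<s x with i <? a
      ... | yes i<a = by-sign (λ j → j ℤ.< + rowLength i → Bead p (pt (+ i) j))
                        (λ n lt → proj₂ (rowLength⁻ (ℤₚ.drop‿+<+ lt))) (λ m _ → upper-negative i m i<a) j
                        (subst (j ℤ.<_) (trans (threshold-upper shape-inBox i<a) (cong +_ (at-applyUpTo rowLength a i<a)))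
                          (X-pt⁻ shape i<s x))
      ... | no i≮a =
        [ id
        , (λ bd → lower j (subst (j ℤ.<_) (threshold-lower shape-inBox a≤i) (X-pt⁻ shape i<s x))
                          (subst (Bead p) (antipode-row j i<s) bd))
        ]′ (bead-or (pt (+ i) j))
        where
        a≤i : a ≤ i
        a≤i = ℕₚ.≮⇒≥ i≮a
        i′ : ℕ
        i′ = s′ ℕ.∸ i
        fromCell : ∀ m → antipode (+ m) ℤ.< - + at shape i′ → Cell i′ m → Bead p (pt (+ i) (antipode (+ m)))
        fromCell m lt cell with i′ <? a
        ... | no i′≮a = middle-negative i<s m (ℕₚ.≮⇒≥ i′≮a) cell
        ... | yes i′<a = contradiction
          (subst (ℤ._< - + at shape i′) (sym (antipode-+ m)) lt)
          (ℤₚ.≤⇒≯ (ℤₚ.neg-mono-≤ (+≤+ (subst (m <_) (sym (at-applyUpTo rowLength a i′<a))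
            (rowLength⁺ (upper-cell<b i′ m cell) cell)))))
        lower : ∀ j → j ℤ.< - + at shape i′ → Bead p (pt (+ i′) (antipode j)) → Bead p (pt (+ i) j)
        lower = by-sign _
          (λ n lt _ → contradiction (ℤₚ.<-≤-trans lt (ℤₚ.neg-mono-≤ (+≤+ z≤n))) λ { (+<+ ()) })
          (λ m lt bd → fromCell m lt (subst (λ z → Bead p (pt (+ i′) z)) (antipode-involutive (+ m)) bd))

      X⇒bead-p : ∀ γ → X shape γ → Bead p γ
      X⇒bead-p = by-coords _ X⇒bead-row

      -- One inclusion implies the other, since both sets contain exactly one point of each
      -- antipodal pair.
      bead⇒X-p : ∀ γ → Bead p γ → X shape γ
      bead⇒X-p γ bd = [ id , (λ x → contradiction (X⇒bead-p _ x) (bead-nand γ bd)) ]′ (X-or shape γ)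

      complete : ∀ r → part p r ≡ part (toPartition shape) r
      complete = beads-determine-parts {p} {toPartition shape}
        (λ γ → X⇒bead shape-inBox γ ∘ bead⇒X-p γ) (λ γ → X⇒bead-p γ ∘ bead⇒X shape-inBox γ)

    -- Size as a quadratic function of the partition in the box

    -- The beads of `∅` are exactly the negative integers, so the results on cores become
    -- inequalities: `upper-negative` puts the points left of column 0 in rows below `a` under 0,
    -- and `upper-cell<b` makes the points from column `b` on nonnegative.
    module ∅-Cores = Completeness ∅ ∅-symmetric (∅-closed s) (∅-closed t)

    -- Whichever of the two antipodes with coordinates (i , j) and
    -- (s − 1 − i , −1 − j) is a bead if row i has m cells.
    value : ℕ → ℕ → ℕ → ℤ
    value m i j = if j ℕ.<ᵇ m then pt (+ i) (+ j) else antipode (pt (+ i) (+ j))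

    box : List (ℕ × ℕ)
    box = cartesianProduct (upTo a) (upTo b)

    box⁻ : ∀ {ij} → ij ∈ box → proj₁ ij < a × proj₂ ij < b
    box⁻ ij∈ = let i∈ , j∈ = ∈-cartesianProduct⁻ (upTo a) (upTo b) ij∈ in ∈-upTo⁻ i∈ , ∈-upTo⁻ j∈

    valueIn : List ℕ → ℕ × ℕ → ℤ
    valueIn g (i , j) = value (at g i) i j

    -- The antipode of a point with nonnegative column has negative column, so no two points of the
    -- box are antipodal and the values are distinct.
    not-antipodal : ∀ {i i′} j j′ → i < s → i′ < s → pt (+ i) (+ j) ≢ antipode (pt (+ i′) (+ j′))
    not-antipodal {i′ = i′} j j′ i<s i′<s eq = ℤₚ.<-irrefl
      (sym (proj₂ (coords-unique {j = + j} {antipode (+ j′)} i<s (flipRow<s i′) (trans eq (antipode-row (+ j′) i′<s)))))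
      (ℤₚ.<-≤-trans (antipode-negative j′) (+≤+ z≤n))

    pt-injective : ∀ {i i′ j j′} → i < s → i′ < s → pt (+ i) (+ j) ≡ pt (+ i′) (+ j′) → (i , j) ≡ (i′ , j′)
    pt-injective i<s i′<s eq = let i≡ , j≡ = coords-unique i<s i′<s eq in cong₂ _,_ i≡ (ℤₚ.+-injective j≡)

    value-injective : ∀ m m′ {i i′ j j′} → i < s → i′ < s → value m i j ≡ value m′ i′ j′ → (i , j) ≡ (i′ , j′)
    value-injective m m′ {i} {i′} {j} {j′} i<s i′<s eq with j ℕ.<ᵇ m | j′ ℕ.<ᵇ m′
    ... | true  | true  = pt-injective i<s i′<s eq
    ... | false | false = pt-injective i<s i′<s (antipode-injective eq)
    ... | true  | false = contradiction eq (not-antipodal j j′ i<s i′<s)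
    ... | false | true  = contradiction (sym eq) (not-antipodal j′ j i′<s i<s)

    module _ {g} (ib : InBox a b g) where

      positive : List ℤ
      positive = filter nonNegative? (map (valueIn g) box)

      positive-unique : Unique positive
      positive-unique = Uniqueₚ.filter⁺ nonNegative? (AllPairs-map-∈ (valueIn g)
        (λ {x} {y} x∈ y∈ x≢y eq → x≢y (value-injective (at g (proj₁ x)) (at g (proj₁ y))
          (upper<s (proj₁ (box⁻ x∈))) (upper<s (proj₁ (box⁻ y∈))) eq))
        (Uniqueₚ.cartesianProduct⁺ (Uniqueₚ.upTo⁺ a) (Uniqueₚ.upTo⁺ b)))

      X-value : ∀ i j → i < a → X g (value (at g i) i j)
      X-value i j i<a with j <? at g i
      ... | yes lt = subst (X g) (sym (if-<-yes lt))
                       (X-pt⁺ g (upper<s i<a) (subst (+ j ℤ.<_) (sym (threshold-upper ib i<a)) (+<+ lt)))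
      ... | no ≮ = subst (X g) (sym (if-<-no (ℕₚ.≮⇒≥ ≮)))
                     ([ (λ x → contradiction (ℤₚ.drop‿+<+ (subst (+ j ℤ.<_) (threshold-upper ib i<a) (X-pt⁻ g (upper<s i<a) x))) ≮)
                      , id ]′ (X-or g (pt (+ i) (+ j))))

      IsValue : ℤ → Set
      IsValue γ = ∃₂ λ i j → i < a × j < b × γ ≡ value (at g i) i j

      -- Nonnegative beads lie in the box or are antipodes of points of the box. The other
      -- candidates, to the left of column 0 in the upper rows or in the middle row, are negative by
      -- the inequalities from `∅`.
      value-of-row : ∀ i j → i < s → X g (pt (+ i) j) → 0ℤ ℤ.≤ pt (+ i) j → IsValue (pt (+ i) j)
      value-of-row i j i<s x 0≤ with i <? a
      ... | yes i<a = upper j (subst (j ℤ.<_) (threshold-upper ib i<a) (X-pt⁻ g i<s x)) 0≤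
        where
        upper : ∀ j → j ℤ.< + at g i → 0ℤ ℤ.≤ pt (+ i) j → IsValue (pt (+ i) j)
        upper = by-sign _
          (λ m lt _ → i , m , i<a , ℕₚ.<-≤-trans (ℤₚ.drop‿+<+ lt) (at-≤ ib i) , sym (if-<-yes (ℤₚ.drop‿+<+ lt)))
          (λ m _ 0≤ → contradiction 0≤ (ℤₚ.<⇒≱ (∅-bead⁻ (∅-Cores.upper-negative i m i<a))))
      ... | no i≮a = lower j (subst (j ℤ.<_) (threshold-lower ib (ℕₚ.≮⇒≥ i≮a)) (X-pt⁻ g i<s x)) 0≤
        where
        i′ : ℕ
        i′ = s′ ℕ.∸ i
        flip : ∀ m → pt (+ i) (antipode (+ m)) ≡ antipode (pt (+ i′) (+ m))
        flip m = trans (cong (λ k → pt (+ k) (antipode (+ m))) (sym (ℕₚ.m∸[m∸n]≡n (ℕ.s≤s⁻¹ i<s))))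
                       (sym (antipode-row (+ m) (flipRow<s i)))
        fromCell : ∀ m → at g i′ ≤ m → 0ℤ ℤ.≤ pt (+ i) (antipode (+ m)) → ∅-Cores.Cell i′ m →
                   IsValue (pt (+ i) (antipode (+ m)))
        fromCell m le 0≤ cell with i′ <? a
        ... | yes i′<a = i′ , m , i′<a , ∅-Cores.upper-cell<b i′ m cell , trans (flip m) (sym (if-<-no le))
        ... | no i′≮a = contradiction 0≤ (ℤₚ.<⇒≱ (∅-bead⁻ (∅-Cores.middle-negative i<s m (ℕₚ.≮⇒≥ i′≮a) cell)))
        below : ∀ m → antipode (+ m) ℤ.< - + at g i′ → at g i′ ≤ m
        below m lt = ℕₚ.≮⇒≥ λ m<x → ℤₚ.<⇒≱ (subst (ℤ._< - + at g i′) (sym (antipode-+ m)) lt)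
                                              (ℤₚ.neg-mono-≤ (+≤+ m<x))
        lower : ∀ j → j ℤ.< - + at g i′ → 0ℤ ℤ.≤ pt (+ i) j → IsValue (pt (+ i) j)
        lower = by-sign _
          (λ n lt _ → contradiction (ℤₚ.<-≤-trans lt (ℤₚ.neg-mono-≤ (+≤+ z≤n))) λ { (+<+ ()) })
          (λ m lt 0≤ → fromCell m (below m lt) 0≤ (∅-bead⁺ (antipode-sign (subst (0ℤ ℤ.≤_) (flip m) 0≤))))

      X⇒value : ∀ γ → X g γ → 0ℤ ℤ.≤ γ → IsValue γ
      X⇒value = by-coords _ value-of-row

      hook⇒positive : ∀ {γ} → γ ∈ map +_ (hooks g) → γ ∈ positive
      hook⇒positive γ∈ with ∈-map⁻ +_ γ∈
      ... | n , n∈ , refl with X⇒value (+ n) (proj₂ (∈-filter⁻ (λ n → X? g (+ n)) {xs = downFrom hookLimit} n∈)) (+≤+ z≤n)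
      ... | i , j , i<a , j<b , eq = subst (_∈ positive) (sym eq) (∈-filter⁺ nonNegative?
              (∈-map⁺ (valueIn g) (∈-cartesianProduct⁺ (∈-upTo⁺ i<a) (∈-upTo⁺ j<b))) (subst (0ℤ ℤ.≤_) eq (+≤+ z≤n)))

      positive⇒hook : ∀ {γ} → γ ∈ positive → γ ∈ map +_ (hooks g)
      positive⇒hook {γ} γ∈ with ∈-filter⁻ nonNegative? {xs = map (valueIn g) box} γ∈
      ... | γ∈map , 0≤γ with ∈-map⁻ (valueIn g) γ∈map
      ... | (i , j) , ij∈ , eq = nonneg γ 0≤γ (subst (X g) (sym eq) (X-value i j (proj₁ (box⁻ ij∈))))
        where
        nonneg : ∀ γ → 0ℤ ℤ.≤ γ → X g γ → γ ∈ map +_ (hooks g)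
        nonneg (+ n) _ x = ∈-map⁺ +_ (∈-filter⁺ (λ n → X? g (+ n)) (∈-downFrom⁺ (X-bounded ib x)) x)

      hooks↭positive : map +_ (hooks g) ↭ positive
      hooks↭positive = ∼bag⇒↭ (unique∧set⇒bag
        (Uniqueₚ.map⁺ ℤₚ.+-injective (Uniqueₚ.filter⁺ (λ n → X? g (+ n)) (Uniqueₚ.downFrom⁺ hookLimit)))
        positive-unique (mk⇔ hook⇒positive positive⇒hook))

      -- The index set on the right is the same for every `g`, which makes the sizes of different
      -- cores comparable term by term.
      size-as-box-sum : + size (toPartition g) ≡ total (λ i → total (λ j → hookAt⁺ (value (at g i) i j)) (upTo b)) (upTo a)
      size-as-box-sum = begin
        + size (toPartition g)                              ≡⟨ cong +_ (size-fromHooks (hooks g) (hooks-decreasing g)) ⟩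
        + sum (map (λ n → suc n ℕ.+ n) (hooks g))           ≡⟨ pos-sum (λ n → suc n ℕ.+ n) (hooks g) ⟩
        total (λ n → hookAt (+ n)) (hooks g)                ≡⟨ total-map hookAt +_ (hooks g) ⟨
        total hookAt (map +_ (hooks g))                     ≡⟨ total-↭ hookAt hooks↭positive ⟩
        total hookAt positive                               ≡⟨ total-hookAt⁺ (map (valueIn g) box) ⟨
        total hookAt⁺ (map (valueIn g) box)                 ≡⟨ total-map hookAt⁺ (valueIn g) box ⟩
        total (hookAt⁺ ∘ valueIn g) box                     ≡⟨ total-cartesianProduct (hookAt⁺ ∘ valueIn g) (upTo a) (upTo b) ⟩
        total (λ i → total (λ j → hookAt⁺ (value (at g i) i j)) (upTo b)) (upTo a) ∎
        where open ≡-Reasoning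

    slope : ℤ → ℤ
    slope i = 1ℤ - S + + 2 * i

    rowTerm : ℕ → ℕ → ℤ
    rowTerm i m = term S T (slope (+ i)) (+ m)

    opaque
      unfolding pt

      hookAt-pt : ∀ i j → hookAt (pt i j) ≡ T * slope i + S * (j + j + 1ℤ)
      hookAt-pt i j = by-2H {k = -1ℤ} (lem (+ s′) (+ t′) H i j)
        where
        lem : ∀ s t h i j → 1ℤ + ((1ℤ + t) * i + (1ℤ + s) * j - h) + ((1ℤ + t) * i + (1ℤ + s) * j - h) ≡
          ((1ℤ + t) * (1ℤ - (1ℤ + s) + + 2 * i) + (1ℤ + s) * (j + j + 1ℤ)) + -1ℤ * ((h + h) - s * t)
        lem = solve-∀

    rowBase : ℕ → ℤ
    rowBase i = total (λ j → hookAt⁺ (antipode (pt (+ i) (+ j)))) (upTo b)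

    -- Each of the `m` cells replaces an antipode by the point itself, which adds `hookAt` of the
    -- point by `hookAt-split`. These increments form an arithmetic progression in j, whose sum is
    -- `rowTerm i m`.
    row-sum : ∀ i m → m ≤ b → total (λ j → hookAt⁺ (value m i j)) (upTo b) ≡ rowBase i + rowTerm i m
    row-sum i m m≤b = begin
      total (λ j → hookAt⁺ (value m i j)) (upTo b)
        ≡⟨ total-cong (upTo b) (λ {j} _ → split j) ⟩
      total (λ j → hookAt⁺ (antipode (pt (+ i) (+ j))) + extra j) (upTo b)
        ≡⟨ total-+ _ extra (upTo b) ⟩
      rowBase i + total extra (upTo b)
        ≡⟨ cong (_+_ (rowBase i)) (total-below (λ j → hookAt (pt (+ i) (+ j))) m b m≤b) ⟩
      rowBase i + total (λ j → hookAt (pt (+ i) (+ j))) (upTo m)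
        ≡⟨ cong (_+_ (rowBase i)) (total-cong (upTo m) (λ {j} _ → hookAt-pt (+ i) (+ j))) ⟩
      rowBase i + total (λ j → T * slope (+ i) + S * (+ j + + j + 1ℤ)) (upTo m)
        ≡⟨ cong (_+_ (rowBase i)) (total-odd S (T * slope (+ i)) m) ⟩
      rowBase i + rowTerm i m ∎
      where
      open ≡-Reasoning
      extra : ℕ → ℤ
      extra j = if j ℕ.<ᵇ m then hookAt (pt (+ i) (+ j)) else 0ℤ
      split : ∀ j → hookAt⁺ (value m i j) ≡ hookAt⁺ (antipode (pt (+ i) (+ j))) + extra j
      split j with j ℕ.<ᵇ m
      ... | true  = hookAt-split (pt (+ i) (+ j))
      ... | false = sym (ℤₚ.+-identityʳ _)

    -- The beads of ∅ are the negative integers, so all values of its box vanish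
    -- under hookAt⁺, which gives the constant term of each row.
    ∅-row : ℕ → ℕ
    ∅-row = ∅-Cores.rowLength

    ∅-row≤b : ∀ i → ∅-row i ≤ b
    ∅-row≤b i = ℕₚ.≤-trans (Listₚ.length-filter (∅-Cores.cell? i) (upTo b)) (ℕₚ.≤-reflexive (Listₚ.length-upTo b))

    value-∅-negative : ∀ i j → j < b → value (∅-row i) i j ℤ.< 0ℤ
    value-∅-negative i j j<b with j <? ∅-row i
    ... | yes lt = subst (ℤ._< 0ℤ) (sym (if-<-yes lt)) (∅-bead⁻ (proj₂ (∅-Cores.rowLength⁻ {i} lt)))
    ... | no ≮ = subst (ℤ._< 0ℤ) (sym (if-<-no (ℕₚ.≮⇒≥ ≮)))
                   (≤⇒antipode< (ℤₚ.≮⇒≥ λ neg → ≮ (∅-Cores.rowLength⁺ {i} j<b (∅-bead⁺ neg))))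

    rowBase≡ : ∀ i → rowBase i ≡ - rowTerm i (∅-row i)
    rowBase≡ i = begin
      rowBase i                                           ≡⟨ lem (rowBase i) (rowTerm i (∅-row i)) ⟩
      (rowBase i + rowTerm i (∅-row i)) - rowTerm i (∅-row i)     ≡⟨ cong (_- rowTerm i (∅-row i)) (row-sum i (∅-row i) (∅-row≤b i)) ⟨
      total (λ j → hookAt⁺ (value (∅-row i) i j)) (upTo b) - rowTerm i (∅-row i)
        ≡⟨ cong (_- rowTerm i (∅-row i)) (total-cong (upTo b) λ {j} j∈ → hookAt⁺-negative (value-∅-negative i j (∈-upTo⁻ j∈))) ⟩
      total (λ _ → 0ℤ) (upTo b) - rowTerm i (∅-row i)         ≡⟨ cong (_- rowTerm i (∅-row i)) (trans (total-const 0ℤ (upTo b)) (ℤₚ.*-zeroˡ (+ length (upTo b)))) ⟩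
      0ℤ - rowTerm i (∅-row i)                                ≡⟨ ℤₚ.+-identityˡ _ ⟩
      - rowTerm i (∅-row i)                                   ∎
      where
      open ≡-Reasoning
      lem : ∀ x y → x ≡ (x + y) - y
      lem = solve-∀

    base : ℤ
    base = total (λ i → rowTerm i (∅-row i)) (upTo a)

    size-formula : ∀ {g} → InBox a b g → + size (toPartition g) ≡ quad S T (1ℤ - S) g - base
    size-formula {g} ib = begin
      + size (toPartition g)
        ≡⟨ size-as-box-sum ib ⟩
      total (λ i → total (λ j → hookAt⁺ (value (at g i) i j)) (upTo b)) (upTo a)
        ≡⟨ total-cong (upTo a) (λ {i} _ → trans (row-sum i (at g i) (at-≤ ib i))
             (trans (ℤₚ.+-comm (rowBase i) _) (cong (_+_ (rowTerm i (at g i))) (trans (rowBase≡ i) (lem (rowTerm i (∅-row i))))))) ⟩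
      total (λ i → rowTerm i (at g i) + -1ℤ * rowTerm i (∅-row i)) (upTo a)
        ≡⟨ total-+ _ (λ i → -1ℤ * rowTerm i (∅-row i)) (upTo a) ⟩
      total (λ i → rowTerm i (at g i)) (upTo a) + total (λ i → -1ℤ * rowTerm i (∅-row i)) (upTo a)
        ≡⟨ cong₂ _+_ (sym (quad-total (1ℤ - S) ib)) (trans (total-* -1ℤ _ (upTo a)) (sym (lem base))) ⟩
      quad S T (1ℤ - S) g - base ∎
      where
      open ≡-Reasoning
      lem : ∀ x → - x ≡ -1ℤ * x
      lem = solve-∀

    -- The constant term and the residues modulo s

    module _ {i} (i<a : i < a) where

      0≤residue : 0ℤ ℤ.≤ pt (+ i) (+ ∅-row i)
      0≤residue = ℤₚ.≮⇒≥ λ neg → ℕₚ.<-irrefl refl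
        (∅-Cores.rowLength⁺ {i} (∅-Cores.upper-cell<b i (∅-row i) (∅-bead⁺ neg)) (∅-bead⁺ neg))

      residue<S : pt (+ i) (+ ∅-row i) ℤ.< S
      residue<S = subst₂ ℤ._<_ (lem (pt (+ i) (+ ∅-row i)) S) (ℤₚ.+-identityˡ S)
        (ℤₚ.+-monoˡ-< S (subst (ℤ._< 0ℤ) (pt-S (+ i) (+ ∅-row i)) (left-negative (∅-row i) (λ lt → proj₂ (∅-Cores.rowLength⁻ {i} lt)))))
        where
        lem : ∀ x s → (x - s) + s ≡ x
        lem = solve-∀
        left-negative : ∀ m → (∀ {j} → j < m → ∅-Cores.Cell i j) → pt (+ i) (-1ℤ + + m) ℤ.< 0ℤ
        left-negative zero    _     = ∅-bead⁻ (∅-Cores.upper-negative i 0 i<a)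
        left-negative (suc m) cells = ∅-bead⁻ (cells ℕₚ.≤-refl)

    -- For i < a this is the least nonnegative lattice point of row i, that is, the residue of t i -
    -- h modulo s.
    residue : ℕ → ℕ
    residue i = ℤ.∣ pt (+ i) (+ ∅-row i) ∣

    residue≡ : ∀ {i} → i < a → + residue i ≡ pt (+ i) (+ ∅-row i)
    residue≡ i<a = ℤₚ.0≤i⇒+∣i∣≡i (0≤residue i<a)

    residue≤s′ : ∀ {i} → i < a → residue i ≤ s′
    residue≤s′ i<a = ℕ.s≤s⁻¹ (ℤₚ.drop‿+<+ (subst (ℤ._< S) (sym (residue≡ i<a)) (residue<S i<a)))

    residue-injective : ∀ {i i′} → i < a → i′ < a → residue i ≡ residue i′ → i ≡ i′
    residue-injective i<a i′<a eq = proj₁ (coords-unique (upper<s i<a) (upper<s i′<a)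
      (trans (sym (residue≡ i<a)) (trans (cong +_ eq) (residue≡ i′<a))))

    -- Otherwise rows i and s − 1 − i′ would share a lattice point.
    residues-not-complementary : ∀ {i i′} → i < a → i′ < a → residue i ℕ.+ residue i′ ≢ s′
    residues-not-complementary {i} {i′} i<a i′<a eq = ℕₚ.<⇒≱ i<a (subst (a ≤_) (sym i≡flip) (flipRow-upper i′<a))
      where
      open ≡-Reasoning
      lem₁ : ∀ r r′ → r - (1ℤ + (r + r′)) ≡ -1ℤ - r′
      lem₁ = solve-∀
      i≡flip : i ≡ s′ ℕ.∸ i′
      i≡flip = proj₁ (coords-unique {j = -1ℤ + + ∅-row i} {antipode (+ ∅-row i′)} (upper<s i<a) (flipRow<s i′) (begin
        pt (+ i) (-1ℤ + + ∅-row i)                        ≡⟨ pt-S (+ i) (+ ∅-row i) ⟩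
        pt (+ i) (+ ∅-row i) - S                          ≡⟨ cong₂ (λ r s′ → r - (1ℤ + + s′)) (sym (residue≡ i<a)) (sym eq) ⟩
        + residue i - (1ℤ + (+ residue i + + residue i′)) ≡⟨ lem₁ (+ residue i) (+ residue i′) ⟩
        antipode (+ residue i′)                       ≡⟨ cong antipode (residue≡ i′<a) ⟩
        antipode (pt (+ i′) (+ ∅-row i′))                 ≡⟨ antipode-row (+ ∅-row i′) (upper<s i′<a) ⟩
        pt (+ (s′ ℕ.∸ i′)) (antipode (+ ∅-row i′))        ∎))

    -- A representative of the pair r, s - 1 - r. The number 2r + 1 - s only changes sign between
    -- the two, so its square is not affected.
    fold : ℕ → ℕ
    fold r with r <? a
    ... | yes _ = r
    ... | no  _ = s′ ℕ.∸ r

    fold-injective : ∀ {r r′} → r ≤ s′ → r′ ≤ s′ → r ℕ.+ r′ ≢ s′ → fold r ≡ fold r′ → r ≡ r′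
    fold-injective {r} {r′} r≤ r′≤ sum≢ eq with r <? a | r′ <? a
    ... | yes _ | yes _ = eq
    ... | no  _ | no  _ = ℕₚ.∸-cancelˡ-≡ r≤ r′≤ eq
    ... | yes _ | no  _ = contradiction (trans (cong (ℕ._+ r′) eq) (ℕₚ.m∸n+n≡m r′≤)) sum≢
    ... | no  _ | yes _ = contradiction (trans (cong (r ℕ.+_) (sym eq)) (ℕₚ.m+[n∸m]≡n r≤)) sum≢

    fold<a : ∀ {r} → r ≤ s′ → r ℕ.+ r ≢ s′ → fold r < a
    fold<a {r} r≤ sum≢ with r <? a
    ... | yes r<a = r<a
    ... | no r≮a = ℕₚ.≰⇒> λ a≤flip → sum≢ (trans (cong (r ℕ.+_) (ℕₚ.≤-antisym (r≤flip a≤flip) flip≤r)) (ℕₚ.m+[n∸m]≡n r≤))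
      where
      open ℕₚ.≤-Reasoning
      s′∸a≤a : s′ ℕ.∸ a ≤ a
      s′∸a≤a = ℕₚ.≤-trans (ℕₚ.∸-monoˡ-≤ a (ℕ.s≤s⁻¹ s≤1+2a)) (ℕₚ.≤-reflexive (ℕₚ.m+n∸n≡m a a))
      a≤r : a ≤ r
      a≤r = ℕₚ.≮⇒≥ r≮a
      flip≤r : s′ ℕ.∸ r ≤ r
      flip≤r = begin
        s′ ℕ.∸ r ≤⟨ ℕₚ.∸-monoʳ-≤ s′ a≤r ⟩
        s′ ℕ.∸ a ≤⟨ s′∸a≤a ⟩
        a        ≤⟨ a≤r ⟩
        r        ∎
      r≤flip : a ≤ s′ ℕ.∸ r → r ≤ s′ ℕ.∸ r
      r≤flip a≤flip = begin
        r                 ≡⟨ ℕₚ.m∸[m∸n]≡n r≤ ⟨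
        s′ ℕ.∸ (s′ ℕ.∸ r) ≤⟨ ℕₚ.∸-monoʳ-≤ s′ a≤flip ⟩
        s′ ℕ.∸ a          ≤⟨ s′∸a≤a ⟩
        a                 ≤⟨ a≤flip ⟩
        s′ ℕ.∸ r          ∎

    square : ℕ → ℤ
    square i = slope (+ i) * slope (+ i)

    square-fold : ∀ {r} → r ≤ s′ → square (fold r) ≡ square r
    square-fold {r} r≤ with r <? a
    ... | yes _ = refl
    ... | no  _ = trans (cong (λ x → slope x * slope x) (flipRow (s≤s r≤))) (lem (+ s′) (+ r))
      where
      lem : ∀ s r → (1ℤ - (1ℤ + s) + + 2 * (s - r)) * (1ℤ - (1ℤ + s) + + 2 * (s - r)) ≡
                    (1ℤ - (1ℤ + s) + + 2 * r) * (1ℤ - (1ℤ + s) + + 2 * r)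
      lem = solve-∀

    -- The residues are distinct and no two of them add up to s - 1, so folding keeps them distinct.
    -- That no residue is complementary to itself excludes the middle value, and all folded residues
    -- are below `a`.
    folded-residues : map (fold ∘ residue) (upTo a) ↭ upTo a
    folded-residues = unique∧⊆⇒↭ _ (upTo a)
      (AllPairs-map-∈ (fold ∘ residue)
        (λ x∈ y∈ x≢y eq → let x<a = ∈-upTo⁻ x∈ ; y<a = ∈-upTo⁻ y∈ in
          x≢y (residue-injective x<a y<a
            (fold-injective (residue≤s′ x<a) (residue≤s′ y<a) (residues-not-complementary x<a y<a) eq)))
        (Uniqueₚ.upTo⁺ a))
      inRange
      (ℕₚ.≤-reflexive (sym (Listₚ.length-map (fold ∘ residue) (upTo a))))
      where
      inRange : ∀ {x} → x ∈ map (fold ∘ residue) (upTo a) → x ∈ upTo a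
      inRange x∈ with ∈-map⁻ (fold ∘ residue) x∈
      ... | i , i∈ , refl = let i<a = ∈-upTo⁻ i∈ in
        ∈-upTo⁺ (fold<a (residue≤s′ i<a) (residues-not-complementary i<a i<a))

    squareSum : ℤ
    squareSum = total square (upTo a)

    residue-squares : total (square ∘ residue) (upTo a) ≡ squareSum
    residue-squares = begin
      total (square ∘ residue) (upTo a)          ≡⟨ total-cong (upTo a) (λ i∈ → square-fold (residue≤s′ (∈-upTo⁻ i∈))) ⟨
      total (square ∘ fold ∘ residue) (upTo a)   ≡⟨ total-map square (fold ∘ residue) (upTo a) ⟨
      total square (map (fold ∘ residue) (upTo a)) ≡⟨ total-↭ square folded-residues ⟩
      total square (upTo a)                      ∎
      where open ≡-Reasoning

    slope-residue : ∀ {i} → i < a → slope (+ residue i) ≡ T * slope (+ i) + + 2 * S * + ∅-row i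
    slope-residue {i} i<a = begin
      slope (+ residue i)                           ≡⟨ cong slope (residue≡ i<a) ⟩
      1ℤ - S + + 2 * pt (+ i) (+ ∅-row i)           ≡⟨ lem₁ S (pt (+ i) (+ ∅-row i)) ⟩
      hookAt (pt (+ i) (+ ∅-row i)) - S             ≡⟨ cong (_- S) (hookAt-pt (+ i) (+ ∅-row i)) ⟩
      T * slope (+ i) + S * (+ ∅-row i + + ∅-row i + 1ℤ) - S
                                                    ≡⟨ lem₂ (T * slope (+ i)) S (+ ∅-row i) ⟩
      T * slope (+ i) + + 2 * S * + ∅-row i         ∎
      where
      open ≡-Reasoning
      lem₁ : ∀ s x → 1ℤ - s + + 2 * x ≡ 1ℤ + x + x - s
      lem₁ = solve-∀
      lem₂ : ∀ c s k → c + s * (k + k + 1ℤ) - s ≡ c + + 2 * s * k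
      lem₂ = solve-∀

    -- Completing the square in s k² + t u k produces the linear form t u + 2 s k, which
    -- `slope-residue` recognises as the slope of a residue.
    4S-rowTerm : ∀ {i} → i < a → + 4 * S * rowTerm i (∅-row i) ≡ square (residue i) + - (T * T) * square i
    4S-rowTerm {i} i<a = begin
      + 4 * S * rowTerm i (∅-row i)  ≡⟨ lem S T (slope (+ i)) (+ ∅-row i) ⟩
      (T * slope (+ i) + + 2 * S * + ∅-row i) * (T * slope (+ i) + + 2 * S * + ∅-row i) + - (T * T) * square i
        ≡⟨ cong (λ x → x * x + - (T * T) * square i) (slope-residue i<a) ⟨
      square (residue i) + - (T * T) * square i ∎
      where
      open ≡-Reasoning
      lem : ∀ s t u k → + 4 * s * (s * k * k + t * u * k) ≡
        (t * u + + 2 * s * k) * (t * u + + 2 * s * k) + - (t * t) * (u * u)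
      lem = solve-∀

    4S-base : + 4 * S * base ≡ (1ℤ - T * T) * squareSum
    4S-base = begin
      + 4 * S * base
        ≡⟨ total-* (+ 4 * S) (λ i → rowTerm i (∅-row i)) (upTo a) ⟨
      total (λ i → + 4 * S * rowTerm i (∅-row i)) (upTo a)
        ≡⟨ total-cong (upTo a) (λ i∈ → 4S-rowTerm (∈-upTo⁻ i∈)) ⟩
      total (λ i → square (residue i) + - (T * T) * square i) (upTo a)
        ≡⟨ total-+ (square ∘ residue) (λ i → - (T * T) * square i) (upTo a) ⟩
      total (square ∘ residue) (upTo a) + total (λ i → - (T * T) * square i) (upTo a)
        ≡⟨ cong₂ _+_ residue-squares (total-* (- (T * T)) square (upTo a)) ⟩
      squareSum + - (T * T) * squareSum
        ≡⟨ lem squareSum T ⟩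
      (1ℤ - T * T) * squareSum ∎
      where
      open ≡-Reasoning
      lem : ∀ v t → v + - (t * t) * v ≡ (1ℤ - t * t) * v
      lem = solve-∀

    -- The squares are symmetric under i ↦ s - 1 - i and vanish in the middle row, so this is half
    -- of the sum s(s² - 1)/3 over all s rows. That is why the result does not depend on the parity
    -- of s, although `a` does.
    6-squareSum : + 6 * squareSum ≡ S * (S * S - 1ℤ)
    6-squareSum = trans (lem₀ squareSum)
      (trans (cong (_*_ (+ 2)) (total-squares (1ℤ - S) a)) (closed (parity (ℕₚ.m≤n⇒m<n∨m≡n 2a≤s))))
      where
      lem₀ : ∀ v → + 6 * v ≡ + 2 * (+ 3 * v)
      lem₀ = solve-∀
      parity : a ℕ.+ a < s ⊎ a ℕ.+ a ≡ s → S ≡ 1ℤ + (+ a + + a) ⊎ S ≡ + a + + a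
      parity (inj₁ lt) = inj₁ (cong +_ (ℕₚ.≤-antisym s≤1+2a lt))
      parity (inj₂ eq) = inj₂ (cong +_ (sym eq))
      A : ℤ
      A = + a
      Claim : ℤ → Set
      Claim S = + 2 * (A * (+ 3 * (1ℤ - S) * (1ℤ - S) + + 6 * (1ℤ - S) * (A - 1ℤ) + + 2 * (A - 1ℤ) * (+ 2 * A - 1ℤ)))
                  ≡ S * (S * S - 1ℤ)
      odd : ∀ a → let S = 1ℤ + (a + a) in
        + 2 * (a * (+ 3 * (1ℤ - S) * (1ℤ - S) + + 6 * (1ℤ - S) * (a - 1ℤ) + + 2 * (a - 1ℤ) * (+ 2 * a - 1ℤ)))
          ≡ S * (S * S - 1ℤ)
      odd = solve-∀
      even : ∀ a → let S = a + a in
        + 2 * (a * (+ 3 * (1ℤ - S) * (1ℤ - S) + + 6 * (1ℤ - S) * (a - 1ℤ) + + 2 * (a - 1ℤ) * (+ 2 * a - 1ℤ)))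
          ≡ S * (S * S - 1ℤ)
      even = solve-∀
      closed : S ≡ 1ℤ + (A + A) ⊎ S ≡ A + A → Claim S
      closed (inj₁ eq) = subst Claim (sym eq) (odd A)
      closed (inj₂ eq) = subst Claim (sym eq) (even A)

    24-base : + 24 * base ≡ (1ℤ - T * T) * (S * S - 1ℤ)
    24-base = ℤₚ.*-cancelˡ-≡ S _ _ (begin
      S * (+ 24 * base)                        ≡⟨ lem₁ S base ⟩
      + 6 * (+ 4 * S * base)                   ≡⟨ cong (_*_ (+ 6)) 4S-base ⟩
      + 6 * ((1ℤ - T * T) * squareSum)         ≡⟨ lem₂ (1ℤ - T * T) squareSum ⟩
      (1ℤ - T * T) * (+ 6 * squareSum)         ≡⟨ cong (_*_ (1ℤ - T * T)) 6-squareSum ⟩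
      (1ℤ - T * T) * (S * (S * S - 1ℤ))        ≡⟨ lem₃ (1ℤ - T * T) S (S * S - 1ℤ) ⟩
      S * ((1ℤ - T * T) * (S * S - 1ℤ))        ∎)
      where
      open ≡-Reasoning
      lem₁ : ∀ s b → s * (+ 24 * b) ≡ + 6 * (+ 4 * s * b)
      lem₁ = solve-∀
      lem₂ : ∀ x v → + 6 * (x * v) ≡ x * (+ 6 * v)
      lem₂ = solve-∀
      lem₃ : ∀ x s y → x * (s * y) ≡ s * (x * y)
      lem₃ = solve-∀

    -- The average over all simultaneous cores

    24-total-size : + 24 * total (λ g → + size (toPartition g)) (boxes a b) ≡
      + count a b * (+ 4 * mean S T (1ℤ - S) (+ a) (+ b) + (T * T - 1ℤ) * (S * S - 1ℤ))
    24-total-size = begin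
      + 24 * total (λ g → + size (toPartition g)) (boxes a b)
        ≡⟨ cong (_*_ (+ 24)) (trans (total-cong (boxes a b) (λ g∈ → size-formula (∈-boxes⁻ a b g∈)))
             (trans (total-+ (quad S T (1ℤ - S)) (λ _ → - base) (boxes a b)) (cong (_+_ Q) (total-const (- base) (boxes a b))))) ⟩
      + 24 * (Q + - base * N)
        ≡⟨ lem₁ Q base N ⟩
      + 4 * (+ 6 * Q) - (+ 24 * base) * N
        ≡⟨ cong₂ (λ q e → + 4 * q - e * N) (quad-mean S T (1ℤ - S) a b) 24-base ⟩
      + 4 * (N * mean S T (1ℤ - S) (+ a) (+ b)) - (1ℤ - T * T) * (S * S - 1ℤ) * N
        ≡⟨ lem₂ N (mean S T (1ℤ - S) (+ a) (+ b)) (T * T) (S * S - 1ℤ) ⟩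
      N * (+ 4 * mean S T (1ℤ - S) (+ a) (+ b) + (T * T - 1ℤ) * (S * S - 1ℤ)) ∎
      where
      open ≡-Reasoning
      Q N : ℤ
      Q = total (quad S T (1ℤ - S)) (boxes a b)
      N = + count a b
      lem₁ : ∀ q e n → + 24 * (q + - e * n) ≡ + 4 * (+ 6 * q) - (+ 24 * e) * n
      lem₁ = solve-∀
      lem₂ : ∀ n m t s → + 4 * (n * m) - (1ℤ - t) * s * n ≡ n * (+ 4 * m + (t - 1ℤ) * s)
      lem₂ = solve-∀

    simultaneousCores : Finite (𝒟 s ∩ 𝒟 t)
    simultaneousCores = record
      { elements = map toPartition (boxes a b)
      ; unique   = AllPairs-map-∈ toPartition
          (λ g∈ g′∈ g≢g′ eq → g≢g′ (toPartition-injective (∈-boxes⁻ a b g∈) (∈-boxes⁻ a b g′∈) eq)) (boxes-unique a b)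
      ; sound    = Allₚ.map⁺ (All.tabulate λ g∈ → toPartition-sound (∈-boxes⁻ a b g∈))
      ; complete = λ p ((sc , core-s) , (_ , core-t)) →
          let sy = selfConjugate⇒symmetric p sc
              open SymmetricBeads p sy
              open Completeness p sy (core⇒closed s′ core-s) (core⇒closed t′ core-t)
          in Anyₚ.map⁺ (Any.map (λ { refl → complete }) (∈-boxes⁺ a b shape-inBox))
      }

    cardinality : ∑ simultaneousCores (λ _ → 1) ≡ count a b
    cardinality = trans (sum-ones (map toPartition (boxes a b))) (Listₚ.length-map toPartition (boxes a b))

    averageSize : MeanIdentity S T (+ a) (+ b) → AverageSize s t
    averageSize identity = simultaneousCores , nz ,
      /-cross (+ ∑ simultaneousCores size) Y (∑ simultaneousCores (λ _ → 1)) 24 {{nz}} (begin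
      + ∑ simultaneousCores size * + 24
        ≡⟨ ℤₚ.*-comm (+ ∑ simultaneousCores size) (+ 24) ⟩
      + 24 * + ∑ simultaneousCores size
        ≡⟨ cong (_*_ (+ 24)) (trans (pos-sum size (map toPartition (boxes a b)))
             (total-map (λ p → + size p) toPartition (boxes a b))) ⟩
      + 24 * total (λ g → + size (toPartition g)) (boxes a b)
        ≡⟨ 24-total-size ⟩
      + count a b * (+ 4 * mean S T (1ℤ - S) (+ a) (+ b) + (T * T - 1ℤ) * (S * S - 1ℤ))
        ≡⟨ cong₂ (λ n y → + n * y) (sym cardinality) identity ⟩
      + ∑ simultaneousCores (λ _ → 1) * Y
        ≡⟨ ℤₚ.*-comm _ Y ⟩
      Y * + ∑ simultaneousCores (λ _ → 1) ∎)
      where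
      open ≡-Reasoning
      Y : ℤ
      Y = (S - 1ℤ) * (T - 1ℤ) * (S + T + 1ℤ)
      nz : NonZero (∑ simultaneousCores (λ _ → 1))
      nz = ℕ.>-nonZero (subst (0 <_) (sym cardinality) (count>0 a b))

theorem1p2 : (s t : ℕ) → 1 ≤ s → 1 ≤ t → Coprime s t →
    Σ[ F ∈ Finite (𝒟 s ∩ 𝒟 t) ]
    Σ[ nz ∈ NonZero (∑ F (λ _ → 1)) ]
    _/_ (+ ∑ F size) (∑ F (λ _ → 1)) {{nz}}
    ≡ ((+ s - 1ℤ) * (+ t - 1ℤ) * (+ s + + t + 1ℤ)) / 24
theorem1p2 (suc s′) (suc t′) _ _ coprime with halve (suc s′) | halve (suc t′)
... | a , inj₁ s≡ | b , inj₁ t≡ =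
  contradiction (coprime (divides a (trans s≡ (double a)) , divides b (trans t≡ (double b)))) λ ()
  where
  double : ∀ n → n ℕ.+ n ≡ n ℕ.* 2
  double n = trans (cong (n ℕ.+_) (sym (ℕₚ.+-identityʳ n))) (ℕₚ.*-comm 2 n)
-- Coprimality leaves at least one of s and t odd, and halving the even one of s - 1 and t - 1 gives
-- the integer h; here t - 1 = 2b and h = (s - 1) b.
... | a , inj₁ s≡ | b , inj₂ refl =
  Lattice.Cores.averageSize s′ (b ℕ.+ b) (s′ ℕ.* b) coprime (sym (ℕₚ.*-distribˡ-+ s′ b b)) a b
    (ℕₚ.≤-reflexive (sym s≡)) (ℕₚ.≤-trans (ℕₚ.≤-reflexive s≡) (ℕₚ.n≤1+n _)) (ℕₚ.n≤1+n _) ℕₚ.≤-refl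
    (subst (λ s → MeanIdentity (+ s) (1ℤ + (+ b + + b)) (+ a) (+ b)) (sym s≡) (even-odd (+ a) (+ b)))
... | a , inj₂ refl | b , inj₁ t≡ =
  Lattice.Cores.averageSize (a ℕ.+ a) t′ (a ℕ.* t′) coprime (sym (ℕₚ.*-distribʳ-+ t′ a a)) a b
    (ℕₚ.n≤1+n _) ℕₚ.≤-refl (ℕₚ.≤-reflexive (sym t≡)) (ℕₚ.≤-trans (ℕₚ.≤-reflexive t≡) (ℕₚ.n≤1+n _))
    (subst (λ t → MeanIdentity (1ℤ + (+ a + + a)) (+ t) (+ a) (+ b)) (sym t≡) (odd-even (+ a) (+ b)))
... | a , inj₂ refl | b , inj₂ refl =
  Lattice.Cores.averageSize (a ℕ.+ a) (b ℕ.+ b) (a ℕ.* (b ℕ.+ b)) coprime (sym (ℕₚ.*-distribʳ-+ (b ℕ.+ b) a a)) a b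
    (ℕₚ.n≤1+n _) ℕₚ.≤-refl (ℕₚ.n≤1+n _) ℕₚ.≤-refl (odd-odd (+ a) (+ b))
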